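{- Let $r\ge 3$ and $k\ge 3$ be integers and let $G$ be a $\mathcal{G}_k^{(r)}$-free $r$-graph. Let $\mathcal{M}_1$, $\mathcal{M}_2$ and $\mathcal{M}'_2$ be as in the context. Suppose $F\in\mathcal{M}'_2$ satisfies Property $\mathbb{P}$. Then for every $S\in\mathcal{M}_1$ with $S\not\subseteq F$ such that $F\cup S\in\mathcal{M}'_2$, we have $|S|=2$, and $F\cup S$ also satisfies Property $\mathbb{P}$.
   Context: An $r$-graph is identified with its edge set; $|H|$ is its number of edges and $V(H)=\bigcup_{e\in H}e$. The family $\mathcal{G}_k^{(r)}$ consists of all $r$-graphs $H$ such that either $|H|=k$ and $|V(H)|\le (r-2)k+2$, or $|H|=\ell$ and $|V(H)|\le (r-2)\ell+1$ for some $\ell\in\{2,\dots,k-1\}$; $G$ is $\mathcal{G}_k^{(r)}$-free if it contains no member of this family as a subgraph (subset of edges). For $F\subseteq G$ and distinct vertices $x,y$, let $C_F(xy)$ be the set of integers $i\ge 0$ for which there exist $i$ distinct edges $e_1,\dots,e_i\in F$ with $|\{x,y\}\cup e_1\cup\dots\cup e_i|\le (r-2)i+2$; we say $F$ $i$-claims $xy$ if $i\in C_F(xy)$, and $F$ $\overline{1}2$-claims $xy$ if $2\in C_F(xy)$ and $1\notin C_F(xy)$. A diamond is an $r$-graph with exactly two edges, which intersect in exactly two vertices. An $r$-graph $F$ is connected if for any edges $X,Y\in F$ there are edges $X=X_1,\dots,X_m=Y$ of $F$ with $|X_i\cap X_{i+1}|\ge 2$ for all $i$. $\mathcal{M}_1$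 is the partition of $E(G)$ into maximal connected subgraphs (the 1-clusters). Edge-disjoint $F,H\subseteq G$ are $(1|2)$-mergeable (resp. $(2|1)$-mergeable) via a pair $xy$ if $1\in C_F(xy)$ and $2\in C_H(xy)$ (resp. $2\in C_F(xy)$ and $1\in C_H(xy)$); they are $1|2$-mergeable if they are $(1|2)$- or $(2|1)$-mergeable via some pair. $\mathcal{M}_2$ is a partition of $E(G)$ obtained from $\mathcal{M}_1$ by repeatedly replacing two distinct $1|2$-mergeable parts by their union as long as possible; $\mathcal{M}'_2$ is the set of all parts appearing at some stage of this process (partial 2-clusters). We say 1-clusters $T_1,\dots,T_\ell\in\mathcal{M}_1$ merge in this order if for each $i\in\{2,\dots,\ell\}$, $T_1\cup\dots\cup T_{i-1}$ and $T_i$ are $1|2$-mergeable. For an $r$-graph $H$, a diamond $D\subseteq H$ is flexible in $H$ if each edge $e\in D$ has exactly one vertex in $V(H\setminus D)$. $F\in\mathcal{M}'_2$ satisfies Property $\mathbb{P}$ if for every 1-cluster $T\in\mathcal{M}_1$ contained in $F$ there exist $\ell\ge 1$ and 1-clusters $T_1,\dots,T_\ell\in\mathcal{M}_1$ merging in this order such that $H=\bigcup_{p=1}^\ell T_p\subseteq F$, $|H|=k+1$, $T\in\{T_1,\dots,T_\ell\}$, and $T_1$ and $T_\ell$ are flexible diamonds in $H$ such that $T_1$ $\overline{1}2$-claims some pair that is $1$-claimed by $T_2$, and $T_\ell$ $\overline{1}2$-claims some pair that is $1$-claimed by $T_{\ell-1}$. -}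

module Defs where

open import Data.Nat using (ℕ; zero; suc; _+_; _*_; _∸_; _≤_; _<_)
open import Data.Bool using (Bool; true; false; if_then_else_)
open import Data.Fin using (Fin; zero; suc; toℕ; fromℕ; inject₁)
open import Data.Fin.Subset
  using (Subset; _∈_; _∉_; _⊆_; _∩_; _∪_; _─_; ⋃; ∣_∣; ⁅_⁆; Nonempty; Empty)
  renaming (⊥ to ∅)
open import Data.Vec using (lookup)
open import Data.List using (List; map; allFin)
open import Data.Product using (Σ; ∃; ∃-syntax; _×_; _,_)
open import Data.Sum using (_⊎_)
open import Relation.Nullary using (¬_)
open import Relation.Binary.PropositionalEquality using (_≡_; _≢_)
open import Relation.Binary.Construct.Closure.ReflexiveTransitive using (Star)
open import Function.Definitions using (Injective)
open import Function.Bundles using (_⇔_)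
open import Level using (0ℓ)

-- Conventions.
-- Vertices are Fin n.  An r-graph G with m edges is an injective map
-- G : Fin m → Subset n (edge i ↦ its vertex set), every edge of size r.
-- A subgraph of G (a subset of its edge set) is a  Subset m  of edge indices.

IsRGraph : {n m : ℕ} → ℕ → (Fin m → Subset n) → Set
IsRGraph r G = Injective _≡_ _≡_ G × (∀ i → ∣ G i ∣ ≡ r)

selUnion : {n L : ℕ} → (Fin L → Bool) → (Fin L → Subset n) → Subset n
selUnion {L = L} sel f = ⋃ (map (λ i → if sel i then f i else ∅) (allFin L))

module _ {n m : ℕ} (G : Fin m → Subset n) where

  V : Subset m → Subset n
  V F = selUnion (lookup F) G

  InFamily : ℕ → ℕ → Subset m → Set
  InFamily r k H =
      (∣ H ∣ ≡ k × ∣ V H ∣ ≤ (r ∸ 2) * k + 2)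
    ⊎ (∃[ l ] (2 ≤ l × l ≤ k ∸ 1 × ∣ H ∣ ≡ l × ∣ V H ∣ ≤ (r ∸ 2) * l + 1))

  GkFree : ℕ → ℕ → Set
  GkFree r k = ∀ (H : Subset m) → ¬ InFamily r k H

  Claims : ℕ → Subset m → Fin n → Fin n → ℕ → Set
  Claims r F x y i =
    ∃[ E ] (E ⊆ F × ∣ E ∣ ≡ i × ∣ (⁅ x ⁆ ∪ ⁅ y ⁆) ∪ V E ∣ ≤ (r ∸ 2) * i + 2)

  Claims¬12 : ℕ → Subset m → Fin n → Fin n → Set
  Claims¬12 r F x y = Claims r F x y 2 × ¬ Claims r F x y 1

  IsDiamond : Subset m → Set
  IsDiamond D = ∃[ e ] ∃[ f ] (e ≢ f × e ∈ D × f ∈ D × ∣ D ∣ ≡ 2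
                                × ∣ G e ∩ G f ∣ ≡ 2)

  Adj : Subset m → Fin m → Fin m → Set
  Adj F e f = e ∈ F × f ∈ F × 2 ≤ ∣ G e ∩ G f ∣

  Connected : Subset m → Set
  Connected F = ∀ e f → e ∈ F → f ∈ F → Star (Adj F) e f

  OneCluster : Subset m → Set
  OneCluster T = Nonempty T × Connected T
                 × (∀ T' → T ⊆ T' → Connected T' → T' ≡ T)

  Disjoint : Subset m → Subset m → Set
  Disjoint F H = Empty (F ∩ H)

  Mergeable12via : ℕ → Subset m → Subset m → Fin n → Fin n → Set
  Mergeable12via r F H x y = Claims r F x y 1 × Claims r H x y 2

  Mergeable : ℕ → Subset m → Subset m → Set
  Mergeable r F H = Disjoint F H × ∃[ x ] ∃[ y ] (x ≢ y ×
      (Mergeable12via r F H x y ⊎ Mergeable12via r H F x y))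

  -- partitions of E(G) are given as predicates on subgraphs (the set of parts)
  Parts : Set₁
  Parts = Subset m → Set

  MergeStep : ℕ → Parts → Parts → Set
  MergeStep r P Q = ∃[ A ] ∃[ B ] (P A × P B × A ≢ B × Mergeable r A B ×
      (∀ X → Q X ⇔ ((P X × X ≢ A × X ≢ B) ⊎ X ≡ A ∪ B)))

  record MergeProcess (r : ℕ) : Set₁ where
    field
      steps    : ℕ
      stage    : ℕ → Parts
      start    : ∀ X → stage 0 X ⇔ OneCluster X
      step     : ∀ j → j < steps → MergeStep r (stage j) (stage (suc j))
      terminal : ∀ A B → stage steps A → stage steps B → A ≢ B → ¬ Mergeable r A B

  PartialTwoCluster : {r : ℕ} → MergeProcess r → Subset m → Set
  PartialTwoCluster π X = ∃[ j ] (j ≤ MergeProcess.steps π × MergeProcess.stage π j X)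

  prefixUnion : {L : ℕ} → (Fin L → Subset m) → Fin L → Subset m
  prefixUnion Ts i = selUnion (λ j → lt (toℕ j) (toℕ i)) Ts
    where
    lt : ℕ → ℕ → Bool
    lt _ zero = false
    lt zero (suc _) = true
    lt (suc a) (suc b) = lt a b

  MergeInOrder : ℕ → {L : ℕ} → (Fin L → Subset m) → Set
  MergeInOrder r {L} Ts = (∀ i → OneCluster (Ts i))
    × (∀ (i : Fin L) → 0 < toℕ i → Mergeable r (prefixUnion Ts i) (Ts i))

  FlexibleDiamond : Subset m → Subset m → Set
  FlexibleDiamond H D = D ⊆ H × IsDiamond D
    × (∀ e → e ∈ D → ∣ G e ∩ V (H ─ D) ∣ ≡ 1)

  -- Property P.  The sequence T_1,…,T_ℓ is Ts : Fin (2 + l) → Subset m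
  -- (ℓ = 2 + l; ℓ = 1 cannot occur).
  PropertyP : ℕ → ℕ → Subset m → Set
  PropertyP r k F = ∀ T → OneCluster T → T ⊆ F →
    ∃[ l ] Σ (Fin (2 + l) → Subset m) λ Ts →
      let H     = selUnion (λ _ → true) Ts
          Tfst  = Ts zero
          Tsnd  = Ts (suc zero)
          Tlast = Ts (fromℕ (suc l))
          Tprev = Ts (inject₁ (fromℕ l))
      in MergeInOrder r Ts × H ⊆ F × ∣ H ∣ ≡ suc k
         × (∃[ p ] Ts p ≡ T)
         × FlexibleDiamond H Tfst × FlexibleDiamond H Tlast
         × (∃[ x ] ∃[ y ] (x ≢ y × Claims¬12 r Tfst x y × Claims r Tsnd x y 1))
         × (∃[ x ] ∃[ y ] (x ≢ y × Claims¬12 r Tlast x y × Claims r Tprev x y 1))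

{-# OPTIONS --safe #-}

-- Write s = r - 2 and call an edge set W tight if |V(W)| ≤ s|W| + 2; freeness forbids tight sets of size k.
-- A partial 2-cluster is tight, and from any tight set meeting it one can exhaust it by adding, one or two edges
-- at a time, edges that keep the set tight; inside a 1-cluster one edge at a time suffices. So such growth must
-- jump from size k - 1 to k + 1, by the two edges of a diamond. Laminarity of the merging process shows that
-- F ∪ S arises by merging F with S itself. If F 2-claimed a pair 1-claimed by S, then H minus one of its end
-- diamonds, plus one edge of S, would be a tight set of size k; hence S 2-claims a pair lying in an edge e of F.
-- If |S| ≥ 3, growing e and the two claiming edges of S inside F up to size k - 1 and then inside S reaches size k.
-- Hence |S| = 2. For Property P at S, take H = T_1 ∪ … ∪ T_ℓ from Property P of F at the 1-cluster T of e and
-- exchange an end diamond of H for S, reordering the merges according to whether T is T_{ℓ-1}, an end, or neither.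
-- Flexibility of the new ends is automatic: in a merging tree with k + 1 edges the counting makes every leaf a
-- flexible diamond.
module Submission where

open import Defs
open import Data.Nat using (ℕ; zero; suc; _+_; _*_; _∸_; _≤_; _<_; _≥_; z≤n; s≤s; s≤s⁻¹; _≤?_)
open import Data.Nat.Properties
open import Data.Bool using (Bool; true; false; if_then_else_) renaming (_≟_ to _≟ᵇ_)
open import Data.Fin using (Fin; zero; suc; toℕ; fromℕ; inject₁)
open import Data.Fin.Properties using (any?; toℕ-inject₁) renaming (_≟_ to _≟ᶠ_)
open import Data.Fin.Relation.Unary.Top using (view; ‵fromℕ; ‵inject₁)
open import Data.Fin.Subset using (Subset; inside; outside; _∈_; _∉_; _⊆_; _⊈_; _∩_; _∪_; _─_; ⋃; ∣_∣; ⁅_⁆; Nonempty; Empty) renaming (⊥ to ∅)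
open import Data.Fin.Subset.Properties
open import Data.Vec using ([]; _∷_; lookup; here; there)
open import Data.Vec.Properties using ([]=⇒lookup; lookup⇒[]=) renaming (≡-dec to vec-≡-dec)
open import Data.List using (List; map; allFin; []; _∷_)
open import Data.List.Properties using (map-tabulate; map-cong)
open import Data.List.Membership.Propositional using () renaming (_∈_ to _∈ˡ_)
open import Data.List.Membership.Propositional.Properties using (∈-map⁺; ∈-map⁻; ∈-allFin)
open import Data.List.Relation.Unary.Any using (here; there)
open import Data.Product using (Σ; ∃-syntax; _×_; _,_; proj₁; proj₂)
open import Data.Sum using (_⊎_; inj₁; inj₂; [_,_]′; swap)
open import Data.Empty using (⊥; ⊥-elim)
open import Function using (_∘_; id)
open import Function.Bundles using (Equivalence)
open import Relation.Nullary using (¬_; Dec; yes; no; contradiction)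
open import Relation.Nullary.Decidable using (_×-dec_; ¬?; decidable-stable)
open import Relation.Binary.PropositionalEquality using (_≡_; _≢_; refl; sym; trans; cong; cong₂; subst; subst₂; module ≡-Reasoning)
open import Relation.Binary.Construct.Closure.ReflexiveTransitive using (Star; ε; _◅_; _◅◅_; gmap)
open import Data.Nat.Tactic.RingSolver using (solve-∀)

private variable
  n m : ℕ

-- Finite subsets

∪ˡ : {p q : Subset n} {x : Fin n} → x ∈ p → x ∈ p ∪ q
∪ˡ {q = q} = p⊆p∪q q

∪ʳ : {p q : Subset n} {x : Fin n} → x ∈ q → x ∈ p ∪ q
∪ʳ {p = p} {q} = q⊆p∪q p q

∪⁻ : {p q : Subset n} {x : Fin n} → x ∈ p ∪ q → x ∈ p ⊎ x ∈ q
∪⁻ {p = p} {q} = x∈p∪q⁻ p q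

∪-⊆ : {p q t : Subset n} → p ⊆ t → q ⊆ t → p ∪ q ⊆ t
∪-⊆ h h′ x∈ = [ (λ y → h y) , (λ y → h′ y) ]′ (∪⁻ x∈)

∩⁻ : {p q : Subset n} {x : Fin n} → x ∈ p ∩ q → x ∈ p × x ∈ q
∩⁻ {p = p} {q} = x∈p∩q⁻ p q

─⁺ : {p q : Subset n} {x : Fin n} → x ∈ p → x ∉ q → x ∈ p ─ q
─⁺ = x∈p∧x∉q⇒x∈p─q

─⁻ : {p q : Subset n} {x : Fin n} → x ∈ p ─ q → x ∈ p × x ∉ q
─⁻ {p = p} {q} h = p─q⊆p p q h , ∉ʳ p q h
  where
  ∉ʳ : (p q : Subset n) {x : Fin n} → x ∈ p ─ q → x ∉ q
  ∉ʳ (inside ∷ p) (outside ∷ q) here ()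
  ∉ʳ (_ ∷ p) (_ ∷ q) (there h) (there h′) = ∉ʳ p q h h′

⁅⁆⁻ : {x y : Fin n} → x ∈ ⁅ y ⁆ → x ≡ y
⁅⁆⁻ {y = y} = x∈⁅y⁆⇒x≡y y

_≟ˢ_ : (p q : Subset n) → Dec (p ≡ q)
_≟ˢ_ = vec-≡-dec _≟ᵇ_

Apart : Subset n → Subset n → Set
Apart p q = ∀ {x} → x ∈ p → x ∉ q

apart⇒empty : {p q : Subset n} → Apart p q → Empty (p ∩ q)
apart⇒empty d (x , x∈) = d (proj₁ (∩⁻ x∈)) (proj₂ (∩⁻ x∈))

empty⇒apart : {p q : Subset n} → Empty (p ∩ q) → Apart p q
empty⇒apart d x∈p x∈q = d (_ , x∈p∩q⁺ (x∈p , x∈q))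

⊈⇒witness : {p q : Subset n} → p ⊈ q → ∃[ x ] (x ∈ p × x ∉ q)
⊈⇒witness {p = p} {q} p⊈q with nonempty? (p ─ q)
... | yes (x , x∈) = x , ─⁻ x∈
... | no none = ⊥-elim (p⊈q λ {x} x∈p → decidable-stable (x ∈? q) λ x∉q → none (x , ─⁺ x∈p x∉q))

∣p∪q∣+∣p∩q∣≡∣p∣+∣q∣ : (p q : Subset n) → ∣ p ∪ q ∣ + ∣ p ∩ q ∣ ≡ ∣ p ∣ + ∣ q ∣
∣p∪q∣+∣p∩q∣≡∣p∣+∣q∣ [] [] = refl
∣p∪q∣+∣p∩q∣≡∣p∣+∣q∣ (outside ∷ p) (outside ∷ q) = ∣p∪q∣+∣p∩q∣≡∣p∣+∣q∣ p q
∣p∪q∣+∣p∩q∣≡∣p∣+∣q∣ (outside ∷ p) (inside ∷ q) = trans (cong suc (∣p∪q∣+∣p∩q∣≡∣p∣+∣q∣ p q)) (sym (+-suc _ _))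
∣p∪q∣+∣p∩q∣≡∣p∣+∣q∣ (inside ∷ p) (outside ∷ q) = cong suc (∣p∪q∣+∣p∩q∣≡∣p∣+∣q∣ p q)
∣p∪q∣+∣p∩q∣≡∣p∣+∣q∣ (inside ∷ p) (inside ∷ q) =
  cong suc (trans (+-suc _ _) (trans (cong suc (∣p∪q∣+∣p∩q∣≡∣p∣+∣q∣ p q)) (sym (+-suc _ _))))

apart⇒∣∪∣ : {p q : Subset n} → Apart p q → ∣ p ∪ q ∣ ≡ ∣ p ∣ + ∣ q ∣
apart⇒∣∪∣ {n} {p} {q} d = begin
  ∣ p ∪ q ∣               ≡⟨ sym (+-identityʳ _) ⟩
  ∣ p ∪ q ∣ + 0           ≡⟨ cong (∣ p ∪ q ∣ +_) (sym ∣∩∣≡0) ⟩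
  ∣ p ∪ q ∣ + ∣ p ∩ q ∣   ≡⟨ ∣p∪q∣+∣p∩q∣≡∣p∣+∣q∣ p q ⟩
  ∣ p ∣ + ∣ q ∣           ∎
  where
  open ≡-Reasoning
  ∣∩∣≡0 : ∣ p ∩ q ∣ ≡ 0
  ∣∩∣≡0 = trans (cong ∣_∣ (Empty-unique (apart⇒empty d))) (∣⊥∣≡0 n)

∣insert∣ : {p : Subset n} {x : Fin n} → x ∉ p → ∣ p ∪ ⁅ x ⁆ ∣ ≡ suc ∣ p ∣
∣insert∣ {p = p} {x} x∉p = trans
  (apart⇒∣∪∣ (λ y∈p y∈x → x∉p (subst (_∈ p) (⁅⁆⁻ y∈x) y∈p)))
  (trans (cong (∣ p ∣ +_) (∣⁅x⁆∣≡1 x)) (+-comm _ 1))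

∣pair∣ : {x y : Fin n} → x ≢ y → ∣ ⁅ x ⁆ ∪ ⁅ y ⁆ ∣ ≡ 2
∣pair∣ {x = x} x≢y = trans (∣insert∣ (λ y∈ → x≢y (sym (⁅⁆⁻ y∈)))) (cong suc (∣⁅x⁆∣≡1 x))

⁅⁆⊆ : {p : Subset n} {x : Fin n} → x ∈ p → ⁅ x ⁆ ⊆ p
⁅⁆⊆ {p = p} x∈p y∈ = subst (_∈ p) (sym (⁅⁆⁻ y∈)) x∈p

pair⊆ : {p : Subset n} {x y : Fin n} → x ∈ p → y ∈ p → ⁅ x ⁆ ∪ ⁅ y ⁆ ⊆ p
pair⊆ x∈p y∈p = ∪-⊆ (⁅⁆⊆ x∈p) (⁅⁆⊆ y∈p)

2≤∣∣⁺ : {p : Subset n} {x y : Fin n} → x ≢ y → x ∈ p → y ∈ p → 2 ≤ ∣ p ∣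
2≤∣∣⁺ x≢y x∈p y∈p = ≤-trans (≤-reflexive (sym (∣pair∣ x≢y))) (p⊆q⇒∣p∣≤∣q∣ (pair⊆ x∈p y∈p))

3≤∣∣⁺ : {p : Subset n} {x y z : Fin n} → x ≢ y → x ≢ z → y ≢ z → x ∈ p → y ∈ p → z ∈ p → 3 ≤ ∣ p ∣
3≤∣∣⁺ {x = x} {y} {z} x≢y x≢z y≢z x∈p y∈p z∈p =
  ≤-trans (≤-reflexive (sym (trans (∣insert∣ z∉) (cong suc (∣pair∣ x≢y)))))
          (p⊆q⇒∣p∣≤∣q∣ (∪-⊆ (pair⊆ x∈p y∈p) (⁅⁆⊆ z∈p)))
  where
  z∉ : z ∉ ⁅ x ⁆ ∪ ⁅ y ⁆
  z∉ z∈ = [ (λ h → x≢z (sym (⁅⁆⁻ h))) , (λ h → y≢z (sym (⁅⁆⁻ h))) ]′ (∪⁻ z∈)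

1≤∣∣⁻ : {p : Subset n} → 1 ≤ ∣ p ∣ → Nonempty p
1≤∣∣⁻ {n} {p} 1≤ with nonempty? p
... | yes ne = ne
... | no e = ⊥-elim (<-irrefl refl (subst (1 ≤_) (trans (cong ∣_∣ (Empty-unique e)) (∣⊥∣≡0 n)) 1≤))

1≤∣∣⁺ : {p : Subset n} {x : Fin n} → x ∈ p → 1 ≤ ∣ p ∣
1≤∣∣⁺ {x = x} x∈p = ≤-trans (≤-reflexive (sym (∣⁅x⁆∣≡1 x))) (p⊆q⇒∣p∣≤∣q∣ (⁅⁆⊆ x∈p))

∃-beyond : (p q : Subset n) → ∣ q ∣ < ∣ p ∣ → ∃[ x ] (x ∈ p × x ∉ q)
∃-beyond p q q<p = ⊈⇒witness λ p⊆q → <⇒≱ q<p (p⊆q⇒∣p∣≤∣q∣ p⊆q)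

2≤∣∣⁻ : {p : Subset n} → 2 ≤ ∣ p ∣ → ∃[ x ] ∃[ y ] (x ≢ y × x ∈ p × y ∈ p)
2≤∣∣⁻ {p = p} 2≤ with 1≤∣∣⁻ {p = p} (≤-trans (s≤s z≤n) 2≤)
... | x , x∈p with ∃-beyond p ⁅ x ⁆ (≤-trans (s≤s (≤-reflexive (∣⁅x⁆∣≡1 x))) 2≤)
...   | y , y∈p , y∉x = x , y , (λ { refl → y∉x (x∈⁅x⁆ x) }) , x∈p , y∈p

∣∣≡1⁻ : {p : Subset n} → ∣ p ∣ ≡ 1 → ∃[ x ] p ≡ ⁅ x ⁆
∣∣≡1⁻ {p = p} ∣p∣≡1 = x , ⊆-antisym p⊆x (⁅⁆⊆ x∈p)
  where
  ne = 1≤∣∣⁻ (≤-reflexive (sym ∣p∣≡1))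
  x = proj₁ ne
  x∈p = proj₂ ne
  p⊆x : p ⊆ ⁅ x ⁆
  p⊆x {y} y∈p with y ≟ᶠ x
  ... | yes refl = x∈⁅x⁆ x
  ... | no y≢x = contradiction (subst (2 ≤_) ∣p∣≡1 (2≤∣∣⁺ y≢x y∈p x∈p)) λ { (s≤s ()) }

pair-cover : {p : Subset n} {x y z : Fin n} → ∣ p ∣ ≡ 2 → x ≢ y → x ∈ p → y ∈ p → z ∈ p → z ≡ x ⊎ z ≡ y
pair-cover {x = x} {y} {z} ∣p∣≡2 x≢y x∈p y∈p z∈p with z ≟ᶠ x | z ≟ᶠ y
... | yes z≡x | _ = inj₁ z≡x
... | no _ | yes z≡y = inj₂ z≡y
... | no z≢x | no z≢y = contradiction
  (subst (3 ≤_) ∣p∣≡2 (3≤∣∣⁺ x≢y (z≢x ∘ sym) (z≢y ∘ sym) x∈p y∈p z∈p)) λ { (s≤s (s≤s ())) }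

∣∣≡2⁻ : {p : Subset n} → ∣ p ∣ ≡ 2 → ∃[ x ] ∃[ y ] (x ≢ y × p ≡ ⁅ x ⁆ ∪ ⁅ y ⁆)
∣∣≡2⁻ {p = p} ∣p∣≡2 with 2≤∣∣⁻ {p = p} (≤-reflexive (sym ∣p∣≡2))
... | x , y , x≢y , x∈p , y∈p = x , y , x≢y , ⊆-antisym p⊆ (pair⊆ x∈p y∈p)
  where
  p⊆ : p ⊆ ⁅ x ⁆ ∪ ⁅ y ⁆
  p⊆ z∈p with pair-cover ∣p∣≡2 x≢y x∈p y∈p z∈p
  ... | inj₁ refl = ∪ˡ (x∈⁅x⁆ x)
  ... | inj₂ refl = ∪ʳ (x∈⁅x⁆ y)

∣p∪q∣≤∣q∣⇒p⊆q : {p q : Subset n} → ∣ p ∪ q ∣ ≤ ∣ q ∣ → p ⊆ q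
∣p∪q∣≤∣q∣⇒p⊆q {p = p} {q} ≤q {x} x∈p with x ∈? q
... | yes x∈q = x∈q
... | no x∉q = ⊥-elim (<-irrefl refl (≤-trans (≤-reflexive (sym (∣insert∣ x∉q)))
                 (≤-trans (p⊆q⇒∣p∣≤∣q∣ (∪-⊆ ∪ʳ (⁅⁆⊆ (∪ˡ x∈p)))) ≤q)))

∣∪∣-enlarge : (p q t : Subset n) → ∣ p ∪ t ∣ ≤ ∣ (p ∪ q) ∪ t ∣
∣∪∣-enlarge p q t = p⊆q⇒∣p∣≤∣q∣ {p = p ∪ t} {q = (p ∪ q) ∪ t} (∪-⊆ (λ h → ∪ˡ (∪ˡ h)) ∪ʳ)

─∪-cancel : {p q : Subset n} → q ⊆ p → (p ─ q) ∪ q ≡ p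
─∪-cancel {p = p} {q} q⊆p = ⊆-antisym (∪-⊆ (p─q⊆p p q) q⊆p) back
  where
  back : p ⊆ (p ─ q) ∪ q
  back {x} x∈p with x ∈? q
  ... | yes x∈q = ∪ʳ x∈q
  ... | no x∉q = ∪ˡ (─⁺ x∈p x∉q)

─-apart : {p q : Subset n} → Apart (p ─ q) q
─-apart {p = p} h = proj₂ (─⁻ {p = p} h)

∪-swap : (p q t : Subset n) → (p ∪ q) ∪ t ≡ (p ∪ t) ∪ q
∪-swap p q t = trans (∪-assoc p q t) (trans (cong (p ∪_) (∪-comm q t)) (sym (∪-assoc p t q)))

∈⋃⁻ : {x : Fin n} (ps : List (Subset n)) → x ∈ ⋃ ps → ∃[ p ] (p ∈ˡ ps × x ∈ p)
∈⋃⁻ [] x∈ = ⊥-elim (∉⊥ x∈)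
∈⋃⁻ (p ∷ ps) x∈ with ∪⁻ {p = p} x∈
... | inj₁ x∈p = p , here refl , x∈p
... | inj₂ x∈ps = let q , q∈ , x∈q = ∈⋃⁻ ps x∈ps in q , there q∈ , x∈q

∈⋃⁺ : {x : Fin n} {p : Subset n} {ps : List (Subset n)} → p ∈ˡ ps → x ∈ p → x ∈ ⋃ ps
∈⋃⁺ (here refl) x∈p = ∪ˡ x∈p
∈⋃⁺ (there p∈) x∈p = ∪ʳ (∈⋃⁺ p∈ x∈p)

module _ {n L : ℕ} {sel : Fin L → Bool} {f : Fin L → Subset n} where

  private
    g : Fin L → Subset n
    g i = if sel i then f i else ∅

  ∈selUnion⁺ : {x : Fin n} (i : Fin L) → sel i ≡ true → x ∈ f i → x ∈ selUnion sel f
  ∈selUnion⁺ {x} i sel-i x∈ = ∈⋃⁺ (∈-map⁺ g (∈-allFin i)) (subst (λ b → x ∈ (if b then f i else ∅)) (sym sel-i) x∈)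

  ∈selUnion⁻ : {x : Fin n} → x ∈ selUnion sel f → ∃[ i ] (sel i ≡ true × x ∈ f i)
  ∈selUnion⁻ {x} x∈ =
    let p , p∈ , x∈p = ∈⋃⁻ (map g (allFin L)) x∈
        i , _ , p≡gi = ∈-map⁻ g p∈
    in i , selected i (subst (x ∈_) p≡gi x∈p)
    where
    selected : ∀ i → x ∈ g i → sel i ≡ true × x ∈ f i
    selected i x∈gi with sel i
    ... | true = refl , x∈gi
    ... | false = ⊥-elim (∉⊥ x∈gi)

selUnion-suc : ∀ {n L} (sel : Fin (suc L) → Bool) (f : Fin (suc L) → Subset n) →
  selUnion sel f ≡ (if sel zero then f zero else ∅) ∪ selUnion (sel ∘ suc) (f ∘ suc)
selUnion-suc {L = L} sel f = cong (λ ps → (if sel zero then f zero else ∅) ∪ ⋃ ps)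
  (trans (map-tabulate {n = L} suc g) (sym (map-tabulate {n = L} id (g ∘ suc))))
  where g = λ i → if sel i then f i else ∅

selUnion-cong : ∀ {n L} (sel : Fin L → Bool) {f g : Fin L → Subset n} → (∀ i → f i ≡ g i) → selUnion sel f ≡ selUnion sel g
selUnion-cong {L = L} sel f≗g = cong ⋃ (map-cong (λ i → cong (if sel i then_else ∅) (f≗g i)) (allFin L))

-- Sequences of merges

-- Appending at the end matches merging in order, where the newest cluster comes last; `inject₁`
-- addresses the old entries and `fromℕ` the new one.
_▷_ : ∀ {L} {X : Set} → (Fin L → X) → X → Fin (suc L) → X
_▷_ {zero}  f x _       = x
_▷_ {suc L} f x zero    = f zero
_▷_ {suc L} f x (suc i) = ((f ∘ suc) ▷ x) i

▷-inject₁ : ∀ {L} {X : Set} (f : Fin L → X) (x : X) (i : Fin L) → (f ▷ x) (inject₁ i) ≡ f i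
▷-inject₁ f x zero = refl
▷-inject₁ f x (suc i) = ▷-inject₁ (f ∘ suc) x i

▷-fromℕ : ∀ {L} {X : Set} (f : Fin L → X) (x : X) → (f ▷ x) (fromℕ L) ≡ x
▷-fromℕ {zero} f x = refl
▷-fromℕ {suc L} f x = ▷-fromℕ (f ∘ suc) x

selUnion-none : ∀ {n L} (f : Fin L → Subset n) → selUnion (λ _ → false) f ≡ ∅
selUnion-none {L = zero} f = refl
selUnion-none {L = suc L} f = trans (selUnion-suc _ f) (trans (∪-identityˡ _) (selUnion-none (f ∘ suc)))

total : ∀ {L} → (Fin L → Subset m) → Subset m
total = selUnion (λ _ → true)

total-last : ∀ {L} (Ts : Fin (suc L) → Subset m) → total Ts ≡ total (Ts ∘ inject₁) ∪ Ts (fromℕ L)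
total-last {L = zero} Ts = ∪-comm _ _
total-last {L = suc L} Ts = begin
  total Ts                                                           ≡⟨ selUnion-suc _ Ts ⟩
  Ts zero ∪ total (Ts ∘ suc)                                         ≡⟨ cong (Ts zero ∪_) (total-last (Ts ∘ suc)) ⟩
  Ts zero ∪ (total (Ts ∘ suc ∘ inject₁) ∪ Ts (fromℕ (suc L)))        ≡⟨ sym (∪-assoc _ _ _) ⟩
  (Ts zero ∪ total (Ts ∘ suc ∘ inject₁)) ∪ Ts (fromℕ (suc L))        ≡⟨ cong (_∪ Ts (fromℕ (suc L))) (sym (selUnion-suc _ (Ts ∘ inject₁))) ⟩
  total (Ts ∘ inject₁) ∪ Ts (fromℕ (suc L))                          ∎
  where open ≡-Reasoning

module _ {n m : ℕ} (G : Fin m → Subset n) where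

  prefix-zero : ∀ {L} (Ts : Fin (suc L) → Subset m) → prefixUnion G Ts zero ≡ ∅
  prefix-zero Ts = selUnion-none Ts

  -- The comparison local to prefixUnion ignores the sequence it is defined for, which is why this type-checks.
  prefix-suc : ∀ {L} (Ts : Fin (suc L) → Subset m) (i : Fin L) →
    prefixUnion G Ts (suc i) ≡ Ts zero ∪ prefixUnion G (Ts ∘ suc) i
  prefix-suc Ts i = selUnion-suc _ Ts

  prefix-inject₁ : ∀ {L} (Ts : Fin (suc L) → Subset m) (i : Fin L) →
    prefixUnion G Ts (inject₁ i) ≡ prefixUnion G (Ts ∘ inject₁) i
  prefix-inject₁ Ts zero = trans (prefix-zero Ts) (sym (prefix-zero (Ts ∘ inject₁)))
  prefix-inject₁ {suc L} Ts (suc i) = begin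
    prefixUnion G Ts (suc (inject₁ i))                        ≡⟨ prefix-suc Ts (inject₁ i) ⟩
    Ts zero ∪ prefixUnion G (Ts ∘ suc) (inject₁ i)            ≡⟨ cong (Ts zero ∪_) (prefix-inject₁ (Ts ∘ suc) i) ⟩
    Ts zero ∪ prefixUnion G (Ts ∘ suc ∘ inject₁) i            ≡⟨ sym (prefix-suc (Ts ∘ inject₁) i) ⟩
    prefixUnion G (Ts ∘ inject₁) (suc i)                      ∎
    where open ≡-Reasoning

  prefix-fromℕ : ∀ {L} (Ts : Fin (suc L) → Subset m) → prefixUnion G Ts (fromℕ L) ≡ total (Ts ∘ inject₁)
  prefix-fromℕ {zero} Ts = prefix-zero Ts
  prefix-fromℕ {suc L} Ts = begin
    prefixUnion G Ts (suc (fromℕ L))                   ≡⟨ prefix-suc Ts (fromℕ L) ⟩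
    Ts zero ∪ prefixUnion G (Ts ∘ suc) (fromℕ L)       ≡⟨ cong (Ts zero ∪_) (prefix-fromℕ (Ts ∘ suc)) ⟩
    Ts zero ∪ total (Ts ∘ suc ∘ inject₁)               ≡⟨ sym (selUnion-suc _ (Ts ∘ inject₁)) ⟩
    total (Ts ∘ inject₁)                               ∎
    where open ≡-Reasoning

  prefix-cong : ∀ {L} {Ts Ts′ : Fin L → Subset m} → (∀ i → Ts i ≡ Ts′ i) → ∀ i → prefixUnion G Ts i ≡ prefixUnion G Ts′ i
  prefix-cong eq i = selUnion-cong _ eq

  module _ (r : ℕ) {L : ℕ} where

    merge-init : ∀ {Ts : Fin (suc L) → Subset m} → MergeInOrder G r Ts → MergeInOrder G r (Ts ∘ inject₁)
    merge-init {Ts} (clusters , merges) = clusters ∘ inject₁ , λ i 0<i →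
      subst (λ p → Mergeable G r p (Ts (inject₁ i))) (prefix-inject₁ Ts i)
        (merges (inject₁ i) (subst (0 <_) (sym (toℕ-inject₁ i)) 0<i))

    merge-last : ∀ {Ts : Fin (suc (suc L)) → Subset m} → MergeInOrder G r Ts →
      Mergeable G r (total (Ts ∘ inject₁)) (Ts (fromℕ (suc L)))
    merge-last {Ts} (_ , merges) =
      subst (λ p → Mergeable G r p (Ts (fromℕ (suc L)))) (prefix-fromℕ Ts) (merges (fromℕ (suc L)) (s≤s z≤n))

    merge-▷ : ∀ {Ts : Fin L → Subset m} {D} → MergeInOrder G r Ts → OneCluster G D → Mergeable G r (total Ts) D →
      MergeInOrder G r (Ts ▷ D)
    merge-▷ {Ts} {D} (clusters , merges) cD mD = clusters′ , merges′
      where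
      clusters′ : ∀ i → OneCluster G ((Ts ▷ D) i)
      clusters′ i with view i
      ... | ‵fromℕ = subst (OneCluster G) (sym (▷-fromℕ Ts D)) cD
      ... | ‵inject₁ j = subst (OneCluster G) (sym (▷-inject₁ Ts D j)) (clusters j)

      merges′ : ∀ i → 0 < toℕ i → Mergeable G r (prefixUnion G (Ts ▷ D) i) ((Ts ▷ D) i)
      merges′ i 0<i with view i
      ... | ‵fromℕ = subst₂ (Mergeable G r)
              (sym (trans (prefix-fromℕ (Ts ▷ D)) (selUnion-cong _ (▷-inject₁ Ts D)))) (sym (▷-fromℕ Ts D)) mD
      ... | ‵inject₁ j = subst₂ (Mergeable G r)
              (sym (trans (prefix-inject₁ (Ts ▷ D) j) (prefix-cong (▷-inject₁ Ts D) j))) (sym (▷-inject₁ Ts D j))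
              (merges j (subst (0 <_) (toℕ-inject₁ j) 0<i))

  total-▷ : ∀ {L} (Ts : Fin L → Subset m) D → total (Ts ▷ D) ≡ total Ts ∪ D
  total-▷ Ts D = trans (total-last (Ts ▷ D)) (cong₂ _∪_ (selUnion-cong _ (▷-inject₁ Ts D)) (▷-fromℕ Ts D))

-- Claims, 1-clusters and links

module _ {n m : ℕ} (G : Fin m → Subset n) where

  ∈V⁺ : ∀ {W e x} → e ∈ W → x ∈ G e → x ∈ V G W
  ∈V⁺ {W} {e} e∈W = ∈selUnion⁺ {sel = lookup W} {f = G} e ([]=⇒lookup e∈W)

  ∈V⁻ : ∀ {W x} → x ∈ V G W → ∃[ e ] (e ∈ W × x ∈ G e)
  ∈V⁻ {W} x∈ with ∈selUnion⁻ {sel = lookup W} {f = G} x∈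
  ... | e , eq , x∈e = e , lookup⇒[]= e W eq , x∈e

  V-mono : ∀ {W W′} → W ⊆ W′ → V G W ⊆ V G W′
  V-mono {W} W⊆W′ x∈ with ∈V⁻ {W} x∈
  ... | e , e∈W , x∈e = ∈V⁺ (W⊆W′ e∈W) x∈e

  V-∪ : ∀ W W′ → V G (W ∪ W′) ≡ V G W ∪ V G W′
  V-∪ W W′ = ⊆-antisym split (∪-⊆ (V-mono {W} {W ∪ W′} ∪ˡ) (V-mono {W′} {W ∪ W′} ∪ʳ))
    where
    split : V G (W ∪ W′) ⊆ V G W ∪ V G W′
    split x∈ with ∈V⁻ {W ∪ W′} x∈
    ... | e , e∈ , x∈e = [ (λ h → ∪ˡ (∈V⁺ h x∈e)) , (λ h → ∪ʳ (∈V⁺ h x∈e)) ]′ (∪⁻ e∈)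

  V-⁅⁆ : ∀ e → V G ⁅ e ⁆ ≡ G e
  V-⁅⁆ e = ⊆-antisym V⊆ (∈V⁺ (x∈⁅x⁆ e))
    where
    V⊆ : V G ⁅ e ⁆ ⊆ G e
    V⊆ {x} x∈ with ∈V⁻ {⁅ e ⁆} x∈
    ... | f , f∈ , x∈f = subst (λ h → x ∈ G h) (⁅⁆⁻ f∈) x∈f

  V-pair : ∀ e f → V G (⁅ e ⁆ ∪ ⁅ f ⁆) ≡ G e ∪ G f
  V-pair e f = trans (V-∪ ⁅ e ⁆ ⁅ f ⁆) (cong₂ _∪_ (V-⁅⁆ e) (V-⁅⁆ f))

  Close : Fin m → Fin m → Set
  Close e f = 2 ≤ ∣ G e ∩ G f ∣

  close? : ∀ e f → Dec (Close e f)
  close? e f = 2 ≤? ∣ G e ∩ G f ∣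

  close-sym : ∀ {e f} → Close e f → Close f e
  close-sym {e} {f} = subst (λ p → 2 ≤ ∣ p ∣) (∩-comm (G e) (G f))

  close⁺ : ∀ {e f x y} → x ≢ y → x ∈ G e → y ∈ G e → x ∈ G f → y ∈ G f → Close e f
  close⁺ x≢y x∈e y∈e x∈f y∈f = 2≤∣∣⁺ x≢y (x∈p∩q⁺ (x∈e , x∈f)) (x∈p∩q⁺ (y∈e , y∈f))

  adj-mono : ∀ {W W′} → W ⊆ W′ → ∀ {e f} → Star (Adj G W) e f → Star (Adj G W′) e f
  adj-mono W⊆W′ = gmap id λ { (e∈ , f∈ , c) → W⊆W′ e∈ , W⊆W′ f∈ , c }

  connected-∪ : ∀ {W W′} → Connected G W → Connected G W′ →
    ∀ {e f} → e ∈ W → f ∈ W′ → Close e f → Connected G (W ∪ W′)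
  connected-∪ {W} {W′} conn conn′ {e} {f} e∈ f∈ c a b a∈ b∈ = path (∪⁻ a∈) (∪⁻ b∈)
    where
    path : a ∈ W ⊎ a ∈ W′ → b ∈ W ⊎ b ∈ W′ → Star (Adj G (W ∪ W′)) a b
    path (inj₁ p) (inj₁ q) = adj-mono ∪ˡ (conn a b p q)
    path (inj₂ p) (inj₂ q) = adj-mono ∪ʳ (conn′ a b p q)
    path (inj₁ p) (inj₂ q) = adj-mono ∪ˡ (conn a e p e∈) ◅◅ (∪ˡ e∈ , ∪ʳ f∈ , c) ◅ adj-mono ∪ʳ (conn′ f b f∈ q)
    path (inj₂ p) (inj₁ q) =
      adj-mono ∪ʳ (conn′ a f p f∈) ◅◅ (∪ʳ f∈ , ∪ˡ e∈ , close-sym c) ◅ adj-mono ∪ˡ (conn e b e∈ q)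

  -- Paths can cross between the clusters through the close pair, so `T ∪ T′` is connected, and
  -- maximality of each cluster equates it with both.
  close⇒≡ : ∀ {T T′} → OneCluster G T → OneCluster G T′ → ∀ {e f} → e ∈ T → f ∈ T′ → Close e f → T ≡ T′
  close⇒≡ {T} {T′} (_ , conn , max) (_ , conn′ , max′) e∈ f∈ c =
    trans (sym (max (T ∪ T′) ∪ˡ conn-T∪T′)) (max′ (T ∪ T′) ∪ʳ conn-T∪T′)
    where conn-T∪T′ = connected-∪ conn conn′ e∈ f∈ c

  crossing : ∀ {T W} {a b : Fin m} → a ∈ W → b ∉ W → Star (Adj G T) a b →
    ∃[ e ] ∃[ f ] (e ∈ W × f ∉ W × Adj G T e f)
  crossing a∈ b∉ ε = contradiction a∈ b∉
  crossing {W = W} {a} a∈ b∉ (_◅_ {j = c} step path) with c ∈? W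
  ... | yes c∈ = crossing c∈ b∉ path
  ... | no c∉ = a , c , a∈ , c∉ , step

  ClusterUnion : Subset m → Set
  ClusterUnion K = ∀ {e} → e ∈ K → ∃[ T ] (OneCluster G T × e ∈ T × T ⊆ K)

  cluster-union : ∀ {T} → OneCluster G T → ClusterUnion T
  cluster-union {T} c e∈ = T , c , e∈ , id

  -- 1- and 2-claims with vertex counts replaced by incidences; equivalent to Claims in free r-graphs.
  One : Subset m → Fin n → Fin n → Set
  One W x y = ∃[ e ] (e ∈ W × x ∈ G e × y ∈ G e)

  Two : Subset m → Fin n → Fin n → Set
  Two W x y = ∃[ f ] ∃[ g ] (f ≢ g × f ∈ W × g ∈ W × Close f g × x ∈ G f ∪ G g × y ∈ G f ∪ G g)

  Link : Subset m → Subset m → Set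
  Link A B = ∃[ x ] ∃[ y ] (x ≢ y × (One A x y × Two B x y ⊎ One B x y × Two A x y))

  One-mono : ∀ {W W′ x y} → W ⊆ W′ → One W x y → One W′ x y
  One-mono W⊆W′ (e , e∈ , h) = e , W⊆W′ e∈ , h

  Two-mono : ∀ {W W′ x y} → W ⊆ W′ → Two W x y → Two W′ x y
  Two-mono W⊆W′ (f , g , f≢g , f∈ , g∈ , h) = f , g , f≢g , W⊆W′ f∈ , W⊆W′ g∈ , h

  Link-mono : ∀ {A A′ B B′} → A ⊆ A′ → B ⊆ B′ → Link A B → Link A′ B′
  Link-mono A⊆ B⊆ (x , y , x≢y , inj₁ (o , t)) = x , y , x≢y , inj₁ (One-mono A⊆ o , Two-mono B⊆ t)
  Link-mono A⊆ B⊆ (x , y , x≢y , inj₂ (o , t)) = x , y , x≢y , inj₂ (One-mono B⊆ o , Two-mono A⊆ t)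

  Link-sym : ∀ {A B} → Link A B → Link B A
  Link-sym (x , y , x≢y , h) = x , y , x≢y , swap h

  One⇒V : ∀ {W x y} → One W x y → x ∈ V G W × y ∈ V G W
  One⇒V (e , e∈ , x∈ , y∈) = ∈V⁺ e∈ x∈ , ∈V⁺ e∈ y∈

  ∈V-pair : ∀ {W f g x} → f ∈ W → g ∈ W → x ∈ G f ∪ G g → x ∈ V G W
  ∈V-pair f∈ g∈ x∈ = [ ∈V⁺ f∈ , ∈V⁺ g∈ ]′ (∪⁻ x∈)

  Two⇒V : ∀ {W x y} → Two W x y → x ∈ V G W × y ∈ V G W
  Two⇒V (_ , _ , _ , f∈ , g∈ , _ , x∈ , y∈) = ∈V-pair f∈ g∈ x∈ , ∈V-pair f∈ g∈ y∈

  -- Connectedness of the merging tree of 1-clusters, expressed by cuts.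
  record Conn (K : Subset m) : Set where
    field
      inhabited : Nonempty K
      union     : ClusterUnion K
      cut       : ∀ {W} → W ⊆ K → Nonempty W → ClusterUnion W → K ⊈ W → Link W (K ─ W)

  open Conn

  private
    data Position (A W : Subset m) : Set where
      within  : A ⊆ W → Position A W
      outside : Apart A W → Position A W
      across  : Nonempty (A ∩ W) → A ⊈ W → Position A W

    position : ∀ A W → Position A W
    position A W with A ⊆? W | nonempty? (A ∩ W)
    ... | yes h | _ = within h
    ... | no h | yes h′ = across h′ h
    ... | no _ | no h = outside (empty⇒apart h)

  module _ {s : ℕ} (∣G∣ : ∀ e → ∣ G e ∣ ≡ 2 + s) where

    close-refl : ∀ e → Close e e
    close-refl e = subst (2 ≤_) (sym (trans (cong ∣_∣ (∩-idem (G e))) (∣G∣ e))) (s≤s (s≤s z≤n))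

    meet⇒≡ : ∀ {T T′ e} → OneCluster G T → OneCluster G T′ → e ∈ T → e ∈ T′ → T ≡ T′
    meet⇒≡ {e = e} c c′ e∈ e∈′ = close⇒≡ c c′ e∈ e∈′ (close-refl e)

    absorb : ∀ {K T e} → ClusterUnion K → OneCluster G T → e ∈ T → e ∈ K → T ⊆ K
    absorb {K} u c e∈T e∈K with u e∈K
    ... | T′ , c′ , e∈T′ , T′⊆K = subst (_⊆ K) (meet⇒≡ c′ c e∈T′ e∈T) T′⊆K

    close-closed : ∀ {K K′ e f} → ClusterUnion K → ClusterUnion K′ → e ∈ K → f ∈ K′ → Close e f → f ∈ K
    close-closed u u′ e∈ f∈ c with u e∈ | u′ f∈
    ... | T , cT , e∈T , T⊆K | T′ , cT′ , f∈T′ , _ with close⇒≡ cT cT′ e∈T f∈T′ c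
    ...   | refl = T⊆K f∈T′

    ∪-union : ∀ {A B} → ClusterUnion A → ClusterUnion B → ClusterUnion (A ∪ B)
    ∪-union u u′ e∈ with ∪⁻ e∈
    ... | inj₁ h = let T , c , e∈T , T⊆ = u h in T , c , e∈T , λ x → ∪ˡ (T⊆ x)
    ... | inj₂ h = let T , c , e∈T , T⊆ = u′ h in T , c , e∈T , λ x → ∪ʳ (T⊆ x)

    ∩-union : ∀ {A B} → ClusterUnion A → ClusterUnion B → ClusterUnion (A ∩ B)
    ∩-union {A} {B} u u′ e∈ with u (proj₁ (∩⁻ {p = A} {B} e∈))
    ... | T , c , e∈T , T⊆A = T , c , e∈T , λ x → x∈p∩q⁺ (T⊆A x , absorb u′ c e∈T (proj₂ (∩⁻ {p = A} {B} e∈)) x)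

    ─-union : ∀ {A B} → ClusterUnion A → ClusterUnion B → ClusterUnion (A ─ B)
    ─-union {A} {B} u u′ e∈ with u (proj₁ (─⁻ {p = A} {B} e∈))
    ... | T , c , e∈T , T⊆A = T , c , e∈T , λ x → ─⁺ (T⊆A x) λ x∈B → proj₂ (─⁻ {p = A} {B} e∈) (absorb u′ c x x∈B e∈T)

    cluster-conn : ∀ {T} → OneCluster G T → Conn T
    cluster-conn c@(ne , _) = record
      { inhabited = ne
      ; union = cluster-union c
      ; cut = λ { W⊆T (e , e∈W) uW T⊈W → ⊥-elim (T⊈W (absorb uW c (W⊆T e∈W) e∈W)) }
      }

    -- If `W` splits `A` or `B` properly, a link inside that part crosses the cut. Otherwise `W`
    -- contains one part and misses the other, and the given link crosses.
    conn-∪ : ∀ {A B} → Conn A → Conn B → Link A B → Conn (A ∪ B)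
    conn-∪ {A} {B} cA cB link = record
      { inhabited = let e , e∈ = inhabited cA in e , ∪ˡ e∈
      ; union = ∪-union (union cA) (union cB)
      ; cut = cut′
      }
      where
      split : ∀ {K W} → K ⊆ A ∪ B → Conn K → ClusterUnion W → Nonempty (K ∩ W) → K ⊈ W → Link W ((A ∪ B) ─ W)
      split {K} {W} K⊆ cK uW ne K⊈W = Link-mono (λ h → proj₂ (∩⁻ {p = K} h)) rest
        (cut cK (λ h → proj₁ (∩⁻ h)) ne (∩-union (union cK) uW) λ K⊆ → K⊈W λ h → proj₂ (∩⁻ {p = K} (K⊆ h)))
        where
        rest : K ─ (K ∩ W) ⊆ (A ∪ B) ─ W
        rest h with ─⁻ {p = K} h
        ... | h₁ , h₂ = ─⁺ (K⊆ h₁) λ h∈W → h₂ (x∈p∩q⁺ (h₁ , h∈W))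

      cut′ : ∀ {W} → W ⊆ A ∪ B → Nonempty W → ClusterUnion W → A ∪ B ⊈ W → Link W ((A ∪ B) ─ W)
      cut′ {W} W⊆ (e , e∈) uW ⊈W with position A W | position B W
      ... | across h h′ | _ = split ∪ˡ cA uW h h′
      ... | _ | across h h′ = split ∪ʳ cB uW h h′
      ... | within h | within h′ = ⊥-elim (⊈W (∪-⊆ h h′))
      ... | within h | outside d = Link-mono h (λ b → ─⁺ (∪ʳ b) (d b)) link
      ... | outside d | within h = Link-mono h (λ a → ─⁺ (∪ˡ a) (d a)) (Link-sym link)
      ... | outside d | outside d′ = ⊥-elim ([ (λ h → d h e∈) , (λ h → d′ h e∈) ]′ (∪⁻ (W⊆ e∈)))

    -- A 1-claim uses one edge and a 2-claim two close edges, so the claiming edges in `K` always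
    -- lie in a single 1-cluster.
    localize : ∀ {W K} → ClusterUnion K → Link W K → ∃[ T ] (OneCluster G T × T ⊆ K × Link W T)
    localize {W} u (x , y , x≢y , inj₂ ((e , e∈ , h) , t)) with u e∈
    ... | T , c , e∈T , T⊆ = T , c , T⊆ , x , y , x≢y , inj₂ ((e , e∈T , h) , t)
    localize {W} u (x , y , x≢y , inj₁ (o , (f , g , f≢g , f∈ , g∈ , cl , h))) with u f∈
    ... | T , c , f∈T , T⊆ = T , c , T⊆ , x , y , x≢y ,
      inj₁ (o , (f , g , f≢g , f∈T , close-closed (cluster-union c) u f∈T g∈ cl , cl , h))

    link-split : ∀ {W K} A → ClusterUnion K → ClusterUnion A → Link W K → Link W (K ─ A) ⊎ Link W A
    link-split A uK uA link with localize uK link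
    ... | T , c , T⊆ , link′ with position T A
    ...   | within h = inj₂ (Link-mono id h link′)
    ...   | outside d = inj₁ (Link-mono id (λ h → ─⁺ (T⊆ h) (d h)) link′)
    ...   | across (e , e∈) T⊈A =
      ⊥-elim (T⊈A (absorb uA c (proj₁ (∩⁻ {p = T} {A} e∈)) (proj₂ (∩⁻ {p = T} {A} e∈))))

    -- Flexible diamonds as leaves

    module _ {H A : Subset m} (cA : OneCluster G A) (flex : FlexibleDiamond G H A) where

      private
        contact : Subset n
        contact = V G (H ─ A)

      contact-unique : ∀ {e x y} → e ∈ A → x ∈ G e → y ∈ G e → x ∈ contact → y ∈ contact → x ≡ y
      contact-unique {e} {x} {y} e∈A x∈e y∈e x∈ y∈ with x ≟ᶠ y
      ... | yes x≡y = x≡y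
      ... | no x≢y = contradiction (subst (2 ≤_) (proj₂ (proj₂ flex) e e∈A)
              (2≤∣∣⁺ x≢y (x∈p∩q⁺ (x∈e , x∈)) (x∈p∩q⁺ (y∈e , y∈)))) λ { (s≤s ()) }

      -- Pigeonhole: the diamond has two edges with at most one contact vertex each, so among three
      -- contact vertices two lie on a common edge and coincide.
      contact-cover : ∀ {x y z} → x ≢ y → x ∈ V G A → y ∈ V G A → z ∈ V G A →
        x ∈ contact → y ∈ contact → z ∈ contact → z ≡ x ⊎ z ≡ y
      contact-cover {x} {y} {z} x≢y xA yA zA x∈ y∈ z∈ with proj₁ (proj₂ flex)
      ... | a , b , a≢b , a∈A , b∈A , ∣A∣≡2 , _ = pick (side xA) (side yA) (side zA)
        where
        side : ∀ {v} → v ∈ V G A → v ∈ G a ⊎ v ∈ G b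
        side v∈ with ∈V⁻ {A} v∈
        ... | e , e∈A , v∈e with pair-cover ∣A∣≡2 a≢b a∈A b∈A e∈A
        ...   | inj₁ refl = inj₁ v∈e
        ...   | inj₂ refl = inj₂ v∈e

        pick : x ∈ G a ⊎ x ∈ G b → y ∈ G a ⊎ y ∈ G b → z ∈ G a ⊎ z ∈ G b → z ≡ x ⊎ z ≡ y
        pick (inj₁ p) _ (inj₁ q) = inj₁ (contact-unique a∈A q p z∈ x∈)
        pick (inj₂ p) _ (inj₂ q) = inj₁ (contact-unique b∈A q p z∈ x∈)
        pick _ (inj₁ p) (inj₁ q) = inj₂ (contact-unique a∈A q p z∈ y∈)
        pick _ (inj₂ p) (inj₂ q) = inj₂ (contact-unique b∈A q p z∈ y∈)
        pick (inj₁ p) (inj₁ q) (inj₂ _) = ⊥-elim (x≢y (contact-unique a∈A p q x∈ y∈))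
        pick (inj₂ p) (inj₂ q) (inj₁ _) = ⊥-elim (x≢y (contact-unique b∈A p q x∈ y∈))

      -- No edge of `A` has two contact vertices, so `A` must be the 2-claiming side of the link and
      -- `W` the 1-claiming side.
      attach : ∀ {W} → W ⊆ H ─ A → Link W A →
        ∃[ x ] ∃[ y ] (x ≢ y × One W x y × x ∈ V G A × y ∈ V G A)
      attach W⊆ (x , y , x≢y , inj₁ (o , t)) = x , y , x≢y , o , Two⇒V t
      attach {W} W⊆ (x , y , x≢y , inj₂ ((e , e∈A , x∈e , y∈e) , t)) =
        ⊥-elim (x≢y (contact-unique e∈A x∈e y∈e (inContact (proj₁ (Two⇒V t))) (inContact (proj₂ (Two⇒V t)))))
        where
        inContact : V G W ⊆ contact
        inContact = V-mono {W} {H ─ A} W⊆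

      -- The only pair through which A can be linked to the rest of H is 1-claimed from outside,
      -- hence by a single 1-cluster: A is a leaf of the merging tree.
      attach-close : ∀ {W W′} → W ⊆ H ─ A → W′ ⊆ H ─ A → Link W A → Link W′ A →
        ∃[ e ] ∃[ e′ ] (e ∈ W × e′ ∈ W′ × Close e e′)
      attach-close {W} {W′} W⊆ W′⊆ l l′ with attach W⊆ l | attach W′⊆ l′
      ... | x , y , x≢y , o@(e , e∈ , x∈ , y∈) , xA , yA | u , v , u≢v , o′@(e′ , e′∈ , u∈ , v∈) , uA , vA =
        e , e′ , e∈ , e′∈ , same (contact-cover x≢y xA yA uA x# y# u#) (contact-cover x≢y xA yA vA x# y# v#)
        where
        x# = V-mono {W} {H ─ A} W⊆ (proj₁ (One⇒V o))
        y# = V-mono {W} {H ─ A} W⊆ (proj₂ (One⇒V o))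
        u# = V-mono {W′} {H ─ A} W′⊆ (proj₁ (One⇒V o′))
        v# = V-mono {W′} {H ─ A} W′⊆ (proj₂ (One⇒V o′))
        same : u ≡ x ⊎ u ≡ y → v ≡ x ⊎ v ≡ y → Close e e′
        same (inj₁ refl) (inj₁ refl) = contradiction refl u≢v
        same (inj₁ refl) (inj₂ refl) = close⁺ x≢y x∈ y∈ u∈ v∈
        same (inj₂ refl) (inj₁ refl) = close⁺ x≢y x∈ y∈ v∈ u∈
        same (inj₂ refl) (inj₂ refl) = contradiction refl u≢v

      -- Cutting `K` at `W` and at `A ∪ W` gives two links. If either avoids `A`, it crosses the cut
      -- of `K ─ A`. If both end in `A`, `attach-close` finds close edges in `W` and in the rest
      -- `X`, impossible for disjoint unions of 1-clusters.
      conn-─ : ∀ {K} → Conn K → A ⊆ K → K ⊆ H → Nonempty (K ─ A) → Conn (K ─ A)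
      conn-─ {K} cK A⊆K K⊆H ne = record { inhabited = ne ; union = ─-union (union cK) uA ; cut = cut′ }
        where
        uA : ClusterUnion A
        uA = cluster-union cA

        cut′ : ∀ {W} → W ⊆ K ─ A → Nonempty W → ClusterUnion W → K ─ A ⊈ W → Link W ((K ─ A) ─ W)
        cut′ {W} W⊆ (w , w∈W) uW K─A⊈W = decide
          (link-split A (─-union (union cK) uW) uA
            (cut cK (λ h → proj₁ (─⁻ {p = K} (W⊆ h))) (w , w∈W) uW λ K⊆W → K─A⊈W λ h → K⊆W (proj₁ (─⁻ {p = K} h))))
          (link-split A (∪-union uA uW) uA (Link-sym
            (cut cK (∪-⊆ A⊆K (λ h → proj₁ (─⁻ {p = K} (W⊆ h)))) (w , ∪ʳ w∈W) (∪-union uA uW) K⊈A∪W)))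
          where
          X : Subset m
          X = K ─ (A ∪ W)

          K⊈A∪W : K ⊈ A ∪ W
          K⊈A∪W K⊆ = K─A⊈W λ h → let h₁ , h₂ = ─⁻ {p = K} h in
            [ (λ a → contradiction a h₂) , id ]′ (∪⁻ (K⊆ h₁))

          X⊆ : X ⊆ (K ─ A) ─ W
          X⊆ h with ─⁻ {p = K} h
          ... | h₁ , h₂ = ─⁺ (─⁺ h₁ λ a → h₂ (∪ˡ a)) λ w → h₂ (∪ʳ w)

          W⊆H─A : W ⊆ H ─ A
          W⊆H─A h with ─⁻ {p = K} (W⊆ h)
          ... | h₁ , h₂ = ─⁺ (K⊆H h₁) h₂

          X⊆H─A : X ⊆ H ─ A
          X⊆H─A h with ─⁻ {p = K} h
          ... | h₁ , h₂ = ─⁺ (K⊆H h₁) λ a → h₂ (∪ˡ a)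

          decide : Link W ((K ─ W) ─ A) ⊎ Link W A → Link X ((A ∪ W) ─ A) ⊎ Link X A → Link W ((K ─ A) ─ W)
          decide (inj₁ l) _ = Link-mono id reorder l
            where
            reorder : (K ─ W) ─ A ⊆ (K ─ A) ─ W
            reorder h with ─⁻ {p = K ─ W} h
            ... | h₁ , h₂ with ─⁻ {p = K} h₁
            ...   | h₃ , h₄ = ─⁺ (─⁺ h₃ h₂) h₄
          decide (inj₂ _) (inj₁ l) = Link-mono drop X⊆ (Link-sym l)
            where
            drop : (A ∪ W) ─ A ⊆ W
            drop h with ─⁻ {p = A ∪ W} h
            ... | h₁ , h₂ = [ (λ a → contradiction a h₂) , id ]′ (∪⁻ h₁)
          decide (inj₂ l) (inj₂ l′) with attach-close W⊆H─A X⊆H─A l l′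
          ... | e , e′ , e∈W , e′∈X , c = ⊥-elim (proj₂ (─⁻ {p = K} e′∈X)
                  (∪ʳ (close-closed uW (─-union (union cK) (∪-union uA uW)) e∈W e′∈X c)))

    -- Chain A B K C: 1-clusters A, B, …, C merging in this order, with union K.
    data Chain (A B : Subset m) : Subset m → Subset m → Set where
      start : OneCluster G A → OneCluster G B → Apart A B → Link A B → Chain A B (A ∪ B) B
      _▸_   : ∀ {K C D} → Chain A B K C → OneCluster G D × Apart K D × Link K D → Chain A B (K ∪ D) D

    chain-conn : ∀ {A B K C} → Chain A B K C → Conn K
    chain-conn (start cA cB _ l) = conn-∪ (cluster-conn cA) (cluster-conn cB) l
    chain-conn (ch ▸ (cD , _ , l)) = conn-∪ (chain-conn ch) (cluster-conn cD) l

    chain-first : ∀ {A B K C} → Chain A B K C → OneCluster G A × A ⊆ K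
    chain-first (start cA _ _ _) = cA , ∪ˡ
    chain-first (ch ▸ _) = proj₁ (chain-first ch) , λ h → ∪ˡ (proj₂ (chain-first ch) h)

    chain-second : ∀ {A B K C} → Chain A B K C → OneCluster G B × B ⊆ K × Apart A B
    chain-second (start _ cB d _) = cB , ∪ʳ , d
    chain-second (ch ▸ _) with chain-second ch
    ... | cB , B⊆ , d = cB , (λ h → ∪ˡ (B⊆ h)) , d

    chain-last : ∀ {A B K C} → Chain A B K C → OneCluster G C × C ⊆ K
    chain-last (start _ cB _ _) = cB , ∪ʳ
    chain-last (_ ▸ (cD , _)) = cD , ∪ʳ

    chain-split : ∀ {A B K C} → Chain A B K C → ∃[ R ] (Conn R × A ⊆ R × Apart R C × K ≡ R ∪ C)
    chain-split {A} (start cA _ d _) = A , cluster-conn cA , id , d , refl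
    chain-split (_▸_ {K = K} ch (_ , d , _)) = K , chain-conn ch , proj₂ (chain-first ch) , d , refl

    next-cluster : ∀ {J W} → Conn J → W ⊆ J → Nonempty W → ClusterUnion W → J ⊈ W →
      ∃[ T ] (OneCluster G T × T ⊆ J × Apart W T × Link W T × ∣ W ∪ T ∣ ≥ suc ∣ W ∣)
    next-cluster {J} {W} cJ W⊆J ne uW J⊈W with localize (─-union (union cJ) uW) (cut cJ W⊆J ne uW J⊈W)
    ... | T , cT@((t , t∈T) , _) , T⊆ , l = T , cT , (λ h → proj₁ (─⁻ {p = J} (T⊆ h))) , W#T , l ,
          subst₂ _≤_ (+-comm ∣ W ∣ 1) (sym (apart⇒∣∪∣ W#T)) (+-monoʳ-≤ ∣ W ∣ (1≤∣∣⁺ t∈T))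
      where
      W#T : Apart W T
      W#T w∈W w∈T = proj₂ (─⁻ {p = J} (T⊆ w∈T)) w∈W

    private
      fuel : ∀ {j w w′ d} → j ≤ w + suc d → suc w ≤ w′ → j ≤ w′ + d
      fuel {w = w} {d = d} le lt = ≤-trans le (≤-trans (≤-reflexive (+-suc w d)) (+-monoˡ-≤ d lt))

      exhausted : ∀ {J W : Subset m} → W ⊆ J → ∣ J ∣ ≤ ∣ W ∣ + 0 → J ⊈ W → ⊥
      exhausted W⊆J le J⊈W = <⇒≱ (p⊂q⇒∣p∣<∣q∣ (W⊆J , ⊈⇒witness J⊈W)) (≤-trans le (≤-reflexive (+-identityʳ _)))

    -- Every beginning of a merging order inside `J` can be completed: while something is missing,
    -- the cut property supplies one more linked cluster.
    chain-extend : ∀ {A B J W C} → Conn J → Chain A B W C → W ⊆ J → ∃[ C′ ] Chain A B J C′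
    chain-extend {A} {B} {J} cJ ch W⊆J = go ∣ J ∣ ch W⊆J (m≤n+m _ _)
      where
      -- `d` bounds the number of edges of `J` still missing; it can decrease because each added
      -- cluster is nonempty.
      go : ∀ d {W C} → Chain A B W C → W ⊆ J → ∣ J ∣ ≤ ∣ W ∣ + d → ∃[ C′ ] Chain A B J C′
      go d {W} {C} ch W⊆J le with J ⊆? W
      ... | yes J⊆W = C , subst (λ X → Chain A B X C) (⊆-antisym W⊆J J⊆W) ch
      go zero ch W⊆J le | no J⊈W = ⊥-elim (exhausted W⊆J le J⊈W)
      go (suc d) ch W⊆J le | no J⊈W
        with next-cluster cJ W⊆J (inhabited (chain-conn ch)) (union (chain-conn ch)) J⊈W
      ... | T , cT , T⊆J , W#T , l , lt = go d (ch ▸ (cT , W#T , l)) (∪-⊆ W⊆J T⊆J) (fuel le lt)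

    -- Clusters are added to `N` until the next one completes `M`. This final cluster `L` lies
    -- outside `N` and leaves a connected rest, so it can serve as a new end of a merging sequence.
    last-cluster : ∀ {M N} → Conn M → Conn N → N ⊆ M → M ⊈ N →
      ∃[ W ] ∃[ L ] (Conn W × OneCluster G L × N ⊆ W × Apart W L × Link W L × M ≡ W ∪ L)
    last-cluster {M} {N} cM cN N⊆M M⊈N = go ∣ M ∣ cN id N⊆M M⊈N (m≤n+m _ _)
      where
      go : ∀ d {W} → Conn W → N ⊆ W → W ⊆ M → M ⊈ W → ∣ M ∣ ≤ ∣ W ∣ + d →
        ∃[ W ] ∃[ L ] (Conn W × OneCluster G L × N ⊆ W × Apart W L × Link W L × M ≡ W ∪ L)
      go zero cW N⊆W W⊆M M⊈W le = ⊥-elim (exhausted W⊆M le M⊈W)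
      go (suc d) {W} cW N⊆W W⊆M M⊈W le with next-cluster cM W⊆M (inhabited cW) (union cW) M⊈W
      ... | T , cT , T⊆M , W#T , l , lt with M ⊆? (W ∪ T)
      ...   | yes M⊆ = W , T , cW , cT , N⊆W , W#T , l , ⊆-antisym M⊆ (∪-⊆ W⊆M T⊆M)
      ...   | no M⊈ = go d (conn-∪ cW (cluster-conn cT) l) (λ h → ∪ˡ (N⊆W h)) (∪-⊆ W⊆M T⊆M) M⊈ (fuel le lt)

    -- Tight sets and their growth

    record Tight (W : Subset m) : Set where
      constructor tight
      field bound : ∣ V G W ∣ ≤ s * ∣ W ∣ + 2

    open Tight

    -- Inclusion-exclusion: the two additive constants `2` sum to one `2` too many, and the shared
    -- vertices `x` and `y` absorb the excess.
    tight-∪ : ∀ {W E x y} → Tight W → Tight E → Apart W E → x ≢ y →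
      x ∈ V G W → y ∈ V G W → x ∈ V G E → y ∈ V G E → Tight (W ∪ E)
    tight-∪ {W} {E} tW tE apart x≢y xW yW xE yE = tight (+-cancelʳ-≤ 2 _ _ (begin
      ∣ V G (W ∪ E) ∣ + 2                        ≡⟨ cong (λ p → ∣ p ∣ + 2) (V-∪ W E) ⟩
      ∣ V G W ∪ V G E ∣ + 2                      ≤⟨ +-monoʳ-≤ _ (2≤∣∣⁺ x≢y (x∈p∩q⁺ (xW , xE)) (x∈p∩q⁺ (yW , yE))) ⟩
      ∣ V G W ∪ V G E ∣ + ∣ V G W ∩ V G E ∣      ≡⟨ ∣p∪q∣+∣p∩q∣≡∣p∣+∣q∣ (V G W) (V G E) ⟩
      ∣ V G W ∣ + ∣ V G E ∣                      ≤⟨ +-mono-≤ (bound tW) (bound tE) ⟩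
      (s * ∣ W ∣ + 2) + (s * ∣ E ∣ + 2)          ≡⟨ lemma s ∣ W ∣ ∣ E ∣ ⟩
      (s * (∣ W ∣ + ∣ E ∣) + 2) + 2              ≡⟨ cong (λ c → (s * c + 2) + 2) (sym (apart⇒∣∪∣ apart)) ⟩
      (s * ∣ W ∪ E ∣ + 2) + 2                    ∎))
      where
      open ≤-Reasoning
      lemma : ∀ s w e → (s * w + 2) + (s * e + 2) ≡ (s * (w + e) + 2) + 2
      lemma = solve-∀

    tight-⁅⁆ : ∀ e → Tight ⁅ e ⁆
    tight-⁅⁆ e = tight (≤-reflexive (trans (trans (cong ∣_∣ (V-⁅⁆ e)) (∣G∣ e))
      (trans (+-comm 2 s) (cong (_+ 2) (trans (sym (*-identityʳ s)) (cong (s *_) (sym (∣⁅x⁆∣≡1 e))))))))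

    apart-⁅⁆ : ∀ {W : Subset m} {e} → e ∉ W → Apart W ⁅ e ⁆
    apart-⁅⁆ {W} e∉W f∈W f∈e = e∉W (subst (_∈ W) (⁅⁆⁻ f∈e) f∈W)

    apart-pair : ∀ {W : Subset m} {f g} → f ∉ W → g ∉ W → Apart W (⁅ f ⁆ ∪ ⁅ g ⁆)
    apart-pair f∉W g∉W e∈W e∈ = [ apart-⁅⁆ f∉W e∈W , apart-⁅⁆ g∉W e∈W ]′ (∪⁻ e∈)

    tight-edge : ∀ {W e x y} → Tight W → e ∉ W → x ≢ y → x ∈ V G W → y ∈ V G W →
      x ∈ G e → y ∈ G e → Tight (W ∪ ⁅ e ⁆)
    tight-edge {e = e} tW e∉W x≢y xW yW x∈e y∈e =
      tight-∪ tW (tight-⁅⁆ e) (apart-⁅⁆ e∉W) x≢y xW yW (∈V⁺ (x∈⁅x⁆ e) x∈e) (∈V⁺ (x∈⁅x⁆ e) y∈e)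

    tight-close : ∀ {W e f} → Tight W → e ∈ W → f ∉ W → Close e f → Tight (W ∪ ⁅ f ⁆)
    tight-close {W} {e} {f} tW e∈W f∉W c with 2≤∣∣⁻ {p = G e ∩ G f} c
    ... | x , y , x≢y , x∈ , y∈ with ∩⁻ {p = G e} {G f} x∈ | ∩⁻ {p = G e} {G f} y∈
    ...   | x∈e , x∈f | y∈e , y∈f = tight-edge tW f∉W x≢y (∈V⁺ e∈W x∈e) (∈V⁺ e∈W y∈e) x∈f y∈f

    tight-two : ∀ {W f g x y} → Tight W → f ∉ W → g ∉ W → f ≢ g → Close f g → x ≢ y → x ∈ V G W → y ∈ V G W →
      x ∈ G f ∪ G g → y ∈ G f ∪ G g → Tight (W ∪ (⁅ f ⁆ ∪ ⁅ g ⁆))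
    tight-two {W} {f} {g} tW f∉W g∉W f≢g c x≢y xW yW x∈ y∈ =
      tight-∪ tW (tight-close (tight-⁅⁆ f) (x∈⁅x⁆ f) (λ g∈f → f≢g (sym (⁅⁆⁻ g∈f))) c) (apart-pair f∉W g∉W) x≢y xW yW
        (subst (_ ∈_) (sym (V-pair f g)) x∈) (subst (_ ∈_) (sym (V-pair f g)) y∈)

    ∪-size₁ : ∀ {W : Subset m} {e} → e ∉ W → ∣ W ∪ ⁅ e ⁆ ∣ ≡ ∣ W ∣ + 1
    ∪-size₁ e∉W = trans (∣insert∣ e∉W) (+-comm 1 _)

    ∪-size₂ : ∀ {W : Subset m} {f g} → f ∉ W → g ∉ W → f ≢ g → ∣ W ∪ (⁅ f ⁆ ∪ ⁅ g ⁆) ∣ ≡ ∣ W ∣ + 2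
    ∪-size₂ f∉W g∉W f≢g = trans (apart⇒∣∪∣ (apart-pair f∉W g∉W)) (cong (_ +_) (∣pair∣ f≢g))

    grow-cluster : ∀ {T W} → OneCluster G T → Tight W → Nonempty (T ∩ W) → T ⊈ W →
      ∃[ f ] (f ∈ T × f ∉ W × Tight (W ∪ ⁅ f ⁆))
    grow-cluster {T} {W} (_ , conn , _) tW (a , a∈) T⊈W with ⊈⇒witness T⊈W
    ... | b , b∈T , b∉W with crossing (proj₂ (∩⁻ {p = T} a∈)) b∉W (conn a b (proj₁ (∩⁻ {p = T} a∈)) b∈T)
    ...   | e , f , e∈W , f∉W , _ , f∈T , c = f , f∈T , f∉W , tight-close tW e∈W f∉W c

    data Extension (W K : Subset m) : Set where
      by-edge : ∀ {e} → e ∈ K → e ∉ W → Tight (W ∪ ⁅ e ⁆) → Extension W K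
      by-pair : ∀ {f g} → f ≢ g → f ∈ K → g ∈ K → f ∉ W → g ∉ W → Tight (W ∪ (⁅ f ⁆ ∪ ⁅ g ⁆)) → Extension W K

    -- `W` may reach beyond `K`. If an edge of `K` outside `W` is close to an edge of `W`, it is
    -- added. Otherwise `K ∩ W` is a union of 1-clusters, and the cut property gives a link whose
    -- outer side is added: one edge if it 1-claims, two if it 2-claims.
    grow : ∀ {K W} → Conn K → Tight W → Nonempty (K ∩ W) → K ⊈ W → Extension W K
    grow {K} {W} cK tW ne K⊈W with any? (λ e → any? (λ f →
      (e ∈? W) ×-dec ((f ∈? K) ×-dec ((¬? (f ∈? W)) ×-dec close? e f))))
    ... | yes (e , f , e∈W , f∈K , f∉W , c) = by-edge f∈K f∉W (tight-close tW e∈W f∉W c)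
    ... | no none = extend (cut cK (λ h → proj₁ (∩⁻ h)) ne closed λ K⊆ → K⊈W λ h → proj₂ (∩⁻ {p = K} (K⊆ h)))
      where
      closed : ClusterUnion (K ∩ W)
      closed {e} e∈ with ∩⁻ {p = K} {W} e∈
      ... | e∈K , e∈W with union cK e∈K
      ...   | T , c , e∈T , T⊆K = T , c , e∈T , λ h → x∈p∩q⁺ (T⊆K h , T⊆W h)
        where
        T⊆W : T ⊆ W
        T⊆W {f} f∈T with f ∈? W
        ... | yes f∈W = f∈W
        ... | no f∉W with crossing e∈W f∉W (proj₁ (proj₂ c) e f e∈T f∈T)
        ...   | a , b , a∈W , b∉W , _ , b∈T , cl = ⊥-elim (none (a , b , a∈W , T⊆K b∈T , b∉W , cl))

      fresh : ∀ {e} → e ∈ K ─ (K ∩ W) → e ∈ K × e ∉ W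
      fresh h with ─⁻ {p = K} h
      ... | e∈K , e∉ = e∈K , λ e∈W → e∉ (x∈p∩q⁺ (e∈K , e∈W))

      inW : V G (K ∩ W) ⊆ V G W
      inW = V-mono {K ∩ W} {W} (λ h → proj₂ (∩⁻ {p = K} h))

      extend : Link (K ∩ W) (K ─ (K ∩ W)) → Extension W K
      extend (x , y , x≢y , inj₁ (o , (f , g , f≢g , f∈ , g∈ , c , x∈ , y∈))) with fresh f∈ | fresh g∈
      ... | f∈K , f∉W | g∈K , g∉W = by-pair f≢g f∈K g∈K f∉W g∉W
        (tight-two tW f∉W g∉W f≢g c x≢y (inW (proj₁ (One⇒V o))) (inW (proj₂ (One⇒V o))) x∈ y∈)
      extend (x , y , x≢y , inj₂ ((e , e∈ , x∈ , y∈) , t)) with fresh e∈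
      ... | e∈K , e∉W = by-edge e∈K e∉W
        (tight-edge tW e∉W x≢y (inW (proj₁ (Two⇒V t))) (inW (proj₂ (Two⇒V t))) x∈ y∈)

    ∩-grow : ∀ {K W W′ : Subset m} → W ⊆ W′ → Nonempty (K ∩ W) → Nonempty (K ∩ W′)
    ∩-grow {K} W⊆W′ (e , e∈) = e , x∈p∩q⁺ (proj₁ (∩⁻ {p = K} e∈) , W⊆W′ (proj₂ (∩⁻ {p = K} e∈)))

    conn⇒tight : ∀ {K} → Conn K → Tight K
    conn⇒tight {K} cK with inhabited cK
    ... | e₀ , e₀∈ = go ∣ K ∣ ⁅ e₀ ⁆ (m≤n+m _ _) (tight-⁅⁆ e₀) (e₀ , x∈p∩q⁺ (e₀∈ , x∈⁅x⁆ e₀)) (⁅⁆⊆ e₀∈)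
      where
      go : ∀ d W → ∣ K ∣ ≤ ∣ W ∣ + d → Tight W → Nonempty (K ∩ W) → W ⊆ K → Tight K
      go d W le tW ne W⊆K with K ⊆? W
      ... | yes K⊆W = subst Tight (⊆-antisym W⊆K K⊆W) tW
      go zero W le tW ne W⊆K | no K⊈W with ⊈⇒witness K⊈W
      ... | e , e∈K , e∉W = ⊥-elim (<-irrefl refl (≤-trans (p⊂q⇒∣p∣<∣q∣ (W⊆K , e , e∈K , e∉W))
              (≤-trans le (≤-reflexive (+-identityʳ _)))))
      go (suc d) W le tW ne W⊆K | no K⊈W with grow cK tW ne K⊈W
      ... | by-edge {e} e∈K e∉W t = go d (W ∪ ⁅ e ⁆)
              (≤-trans le (≤-reflexive (trans (sym (+-assoc _ 1 d)) (cong (_+ d) (sym (∪-size₁ e∉W))))))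
              t (∩-grow ∪ˡ ne) (∪-⊆ W⊆K (⁅⁆⊆ e∈K))
      -- Two edges are added although only one unit of fuel is spent, hence the slack `n≤1+n`.
      ... | by-pair {f} {g} f≢g f∈K g∈K f∉W g∉W t = go d (W ∪ (⁅ f ⁆ ∪ ⁅ g ⁆))
              (≤-trans le (≤-trans (+-monoʳ-≤ _ (n≤1+n (suc d)))
                (≤-reflexive (trans (sym (+-assoc _ 2 d)) (cong (_+ d) (sym (∪-size₂ f∉W g∉W f≢g)))))))
              t (∩-grow ∪ˡ ne) (∪-⊆ W⊆K (pair⊆ f∈K g∈K))

    -- Consequences of freeness

    module _ {k : ℕ} (3≤k : 3 ≤ k) (free : GkFree G (2 + s) k) where

      ¬tight-k : ∀ {W} → Tight W → ∣ W ∣ ≡ k → ⊥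
      ¬tight-k {W} tW ∣W∣≡k = free W (inj₁ (∣W∣≡k , subst (λ c → ∣ V G W ∣ ≤ s * c + 2) ∣W∣≡k (bound tW)))

      -- This is the case `l = 2` of the forbidden family, which is in range because `3 ≤ k`. It
      -- makes the vertex bound of a 2-claim sharp.
      pair-spread : ∀ {E} → ∣ E ∣ ≡ 2 → s * 2 + 2 ≤ ∣ V G E ∣
      pair-spread {E} ∣E∣≡2 = subst (_≤ ∣ V G E ∣) (sym (+-suc (s * 2) 1)) (≰⇒> λ V≤ →
        free E (inj₂ (2 , ≤-refl , ∸-monoˡ-≤ 1 3≤k , ∣E∣≡2 , V≤)))

      two-edges : ∀ f g → ∣ G f ∪ G g ∣ + ∣ G f ∩ G g ∣ ≡ (s * 2 + 2) + 2
      two-edges f g = trans (∣p∪q∣+∣p∩q∣≡∣p∣+∣q∣ (G f) (G g)) (trans (cong₂ _+_ (∣G∣ f) (∣G∣ g)) (lemma s))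
        where
        lemma : ∀ s → (2 + s) + (2 + s) ≡ (s * 2 + 2) + 2
        lemma = solve-∀

      close⇒≡2 : ∀ {f g} → f ≢ g → Close f g → ∣ G f ∩ G g ∣ ≡ 2
      close⇒≡2 {f} {g} f≢g c = ≤-antisym (+-cancelˡ-≤ (s * 2 + 2) _ _
        (≤-trans (+-monoˡ-≤ _ (subst (λ p → s * 2 + 2 ≤ ∣ p ∣) (V-pair f g) (pair-spread {⁅ f ⁆ ∪ ⁅ g ⁆} (∣pair∣ f≢g))))
                 (≤-reflexive (two-edges f g)))) c

      claims⇒One : ∀ {F x y} → Claims G (2 + s) F x y 1 → One F x y
      claims⇒One {F} {x} {y} (E , E⊆F , ∣E∣≡1 , small) with ∣∣≡1⁻ {p = E} ∣E∣≡1
      ... | e , refl = e , E⊆F (x∈⁅x⁆ e) , xy⊆ (∪ˡ (x∈⁅x⁆ x)) , xy⊆ (∪ʳ (x∈⁅x⁆ y))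
        where
        xy⊆ : ⁅ x ⁆ ∪ ⁅ y ⁆ ⊆ G e
        xy⊆ = ∣p∪q∣≤∣q∣⇒p⊆q (≤-trans (subst (λ p → ∣ (⁅ x ⁆ ∪ ⁅ y ⁆) ∪ p ∣ ≤ s * 1 + 2) (V-⁅⁆ e) small)
          (≤-reflexive (trans (cong (_+ 2) (*-identityʳ s)) (trans (+-comm s 2) (sym (∣G∣ e))))))

      One⇒claims : ∀ {F x y} → One F x y → Claims G (2 + s) F x y 1
      One⇒claims {F} {x} {y} (e , e∈ , x∈ , y∈) = ⁅ e ⁆ , ⁅⁆⊆ e∈ , ∣⁅x⁆∣≡1 e ,
        ≤-trans (p⊆q⇒∣p∣≤∣q∣ (∪-⊆ (pair⊆ (∈V⁺ (x∈⁅x⁆ e) x∈) (∈V⁺ (x∈⁅x⁆ e) y∈)) id))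
          (subst (λ c → ∣ V G ⁅ e ⁆ ∣ ≤ s * c + 2) (∣⁅x⁆∣≡1 e) (bound (tight-⁅⁆ e)))

      -- By `pair-spread` the two edges alone span at least `s * 2 + 2` vertices, so `x` and `y` add
      -- none. The same bound from above forces the edges to share two vertices.
      claims⇒Two : ∀ {F x y} → Claims G (2 + s) F x y 2 → Two F x y
      claims⇒Two {F} {x} {y} (E , E⊆F , ∣E∣≡2 , small) with ∣∣≡2⁻ {p = E} ∣E∣≡2
      ... | f , g , f≢g , refl = f , g , f≢g , E⊆F (∪ˡ (x∈⁅x⁆ f)) , E⊆F (∪ʳ (x∈⁅x⁆ g)) , close-fg ,
        xy⊆ (∪ˡ (x∈⁅x⁆ x)) , xy⊆ (∪ʳ (x∈⁅x⁆ y))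
        where
        small′ : ∣ (⁅ x ⁆ ∪ ⁅ y ⁆) ∪ (G f ∪ G g) ∣ ≤ s * 2 + 2
        small′ = subst (λ p → ∣ (⁅ x ⁆ ∪ ⁅ y ⁆) ∪ p ∣ ≤ s * 2 + 2) (V-pair f g) small
        xy⊆ : ⁅ x ⁆ ∪ ⁅ y ⁆ ⊆ G f ∪ G g
        xy⊆ = ∣p∪q∣≤∣q∣⇒p⊆q (≤-trans small′ (subst (λ p → s * 2 + 2 ≤ ∣ p ∣) (V-pair f g) (pair-spread {⁅ f ⁆ ∪ ⁅ g ⁆} ∣E∣≡2)))
        close-fg : Close f g
        close-fg = +-cancelˡ-≤ (s * 2 + 2) _ _ (≤-trans (≤-reflexive (sym (two-edges f g)))
          (+-monoˡ-≤ _ (≤-trans (∣q∣≤∣p∪q∣ (⁅ x ⁆ ∪ ⁅ y ⁆) (G f ∪ G g)) small′)))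

      Two⇒claims : ∀ {F x y} → Two F x y → Claims G (2 + s) F x y 2
      Two⇒claims {F} {x} {y} (f , g , f≢g , f∈ , g∈ , c , x∈ , y∈) = ⁅ f ⁆ ∪ ⁅ g ⁆ , pair⊆ f∈ g∈ , ∣pair∣ f≢g ,
        ≤-trans (p⊆q⇒∣p∣≤∣q∣ (∪-⊆ (pair⊆ (inV x∈) (inV y∈)) id))
          (subst (λ c → ∣ V G (⁅ f ⁆ ∪ ⁅ g ⁆) ∣ ≤ s * c + 2) (∣pair∣ f≢g)
            (bound (tight-close (tight-⁅⁆ f) (x∈⁅x⁆ f) (λ g∈f → f≢g (sym (⁅⁆⁻ g∈f))) c)))
        where
        inV : ∀ {z} → z ∈ G f ∪ G g → z ∈ V G (⁅ f ⁆ ∪ ⁅ g ⁆)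
        inV = subst (_ ∈_) (sym (V-pair f g))

      mergeable⇒link : ∀ {A B} → Mergeable G (2 + s) A B → Link A B
      mergeable⇒link (_ , x , y , x≢y , inj₁ (o , t)) = x , y , x≢y , inj₁ (claims⇒One o , claims⇒Two t)
      mergeable⇒link (_ , x , y , x≢y , inj₂ (o , t)) = x , y , x≢y , inj₂ (claims⇒One o , claims⇒Two t)

      link⇒mergeable : ∀ {A B} → Apart A B → Link A B → Mergeable G (2 + s) A B
      link⇒mergeable d (x , y , x≢y , inj₁ (o , t)) = apart⇒empty d , x , y , x≢y , inj₁ (One⇒claims o , Two⇒claims t)
      link⇒mergeable d (x , y , x≢y , inj₂ (o , t)) = apart⇒empty d , x , y , x≢y , inj₂ (One⇒claims o , Two⇒claims t)

      -- Inside a 1-cluster a tight set grows one edge at a time, so it would pass through size k.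
      cluster-blocks : ∀ {T W} → OneCluster G T → Tight W → Nonempty (T ∩ W) → ∣ W ∣ ≤ k → k ≤ ∣ W ∪ T ∣ → ⊥
      cluster-blocks {T} {W₀} c tW₀ ne₀ W₀≤k k≤ = go (k ∸ ∣ W₀ ∣) W₀ (m+[n∸m]≡n W₀≤k) tW₀ ne₀ k≤
        where
        go : ∀ d W → ∣ W ∣ + d ≡ k → Tight W → Nonempty (T ∩ W) → k ≤ ∣ W ∪ T ∣ → ⊥
        go zero W eq tW ne _ = ¬tight-k tW (trans (sym (+-identityʳ _)) eq)
        go (suc d) W eq tW ne k≤ with T ⊆? W
        ... | yes T⊆W = <⇒≱ (subst (∣ W ∣ <_) eq (m<m+n ∣ W ∣ (s≤s z≤n)))
                          (≤-trans k≤ (p⊆q⇒∣p∣≤∣q∣ (∪-⊆ id T⊆W)))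
        ... | no T⊈W with grow-cluster c tW ne T⊈W
        ...   | f , f∈T , f∉W , t = go d (W ∪ ⁅ f ⁆) (trans (cong (_+ d) (∪-size₁ f∉W)) (trans (+-assoc _ 1 d) eq))
                  t (∩-grow ∪ˡ ne) (≤-trans k≤ (p⊆q⇒∣p∣≤∣q∣ mono))
          where
          mono : W ∪ T ⊆ (W ∪ ⁅ f ⁆) ∪ T
          mono = ∪-⊆ (λ h → ∪ˡ (∪ˡ h)) ∪ʳ

      -- `d` counts the edges missing to size `k - 1`. Growth cannot stall, since `K` has at least
      -- `k` edges, and it cannot skip size `k - 1`, since that would mean landing on `k`.
      grow-to : ∀ {K} → Conn K → k ≤ ∣ K ∣ → ∀ d W → suc (∣ W ∣ + d) ≡ k → Tight W → Nonempty (K ∩ W) →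
        ∃[ X ] (W ⊆ X × X ⊆ W ∪ K × Tight X × suc ∣ X ∣ ≡ k)
      grow-to cK k≤ zero W eq tW ne = W , id , ∪ˡ , tW , trans (cong suc (sym (+-identityʳ _))) eq
      grow-to {K} cK k≤ (suc d) W eq tW ne with K ⊆? W
      ... | yes K⊆W = ⊥-elim (<⇒≱ (subst (∣ W ∣ <_) eq (s≤s (m≤m+n ∣ W ∣ _))) (≤-trans k≤ (p⊆q⇒∣p∣≤∣q∣ K⊆W)))
      ... | no K⊈W with grow cK tW ne K⊈W
      grow-to {K} cK k≤ (suc d) W eq tW ne | no _ | by-edge {e} e∈K e∉W t
        with grow-to cK k≤ d (W ∪ ⁅ e ⁆) (trans (cong (λ c → suc (c + d)) (∪-size₁ e∉W)) (trans (cong suc (+-assoc _ 1 d)) eq))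
               t (∩-grow ∪ˡ ne)
      ... | X , W⊆X , X⊆ , tX , ∣X∣ = X , (λ h → W⊆X (∪ˡ h)) , (λ h → ∪-⊆ (∪-⊆ ∪ˡ (λ h′ → ∪ʳ (⁅⁆⊆ e∈K h′))) ∪ʳ (X⊆ h)) , tX , ∣X∣
      -- From size `k - 2`, a pair would produce a tight set of size exactly `k`.
      grow-to cK k≤ (suc zero) W eq tW ne | no _ | by-pair f≢g f∈K g∈K f∉W g∉W t =
        ⊥-elim (¬tight-k t (trans (∪-size₂ f∉W g∉W f≢g) (trans (+-suc _ 1) eq)))
      grow-to cK k≤ (suc (suc d)) W eq tW ne | no _ | by-pair {f} {g} f≢g f∈K g∈K f∉W g∉W t
        with grow-to cK k≤ d (W ∪ (⁅ f ⁆ ∪ ⁅ g ⁆))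
               (trans (cong (λ c → suc (c + d)) (∪-size₂ f∉W g∉W f≢g)) (trans (cong suc (+-assoc _ 2 d)) eq)) t (∩-grow ∪ˡ ne)
      ... | X , W⊆X , X⊆ , tX , ∣X∣ = X , (λ h → W⊆X (∪ˡ h)) , (λ h → ∪-⊆ (∪-⊆ ∪ˡ (λ h′ → ∪ʳ (pair⊆ f∈K g∈K h′))) ∪ʳ (X⊆ h)) , tX , ∣X∣

      -- `Q` has at most `k` edges and, being tight, not exactly `k`. Adding an edge of `A` through
      -- `x` and `y` would give a tight set of size at most `k`, which growth inside `A` would carry
      -- through size `k`.
      leaf-¬one : ∀ {Q A x y} → OneCluster G A → Tight Q → Apart Q A → ∣ Q ∪ A ∣ ≡ suc k →
        x ≢ y → x ∈ V G Q → y ∈ V G Q → ¬ One A x y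
      leaf-¬one {Q} {A} cA tQ Q#A size x≢y xQ yQ (e , e∈A , x∈e , y∈e) =
        cluster-blocks cA (tight-edge tQ e∉Q x≢y xQ yQ x∈e y∈e) (e , x∈p∩q⁺ (e∈A , ∪ʳ (x∈⁅x⁆ e)))
          (subst (_≤ k) (sym (∣insert∣ e∉Q)) (≤∧≢⇒< ∣Q∣≤k (¬tight-k tQ)))
          (≤-trans (n≤1+n k) (≤-trans (≤-reflexive (sym size)) (∣∪∣-enlarge Q _ A)))
        where
        e∉Q : e ∉ Q
        e∉Q e∈Q = Q#A e∈Q e∈A
        ∣Q∣≤k : ∣ Q ∣ ≤ k
        ∣Q∣≤k = s≤s⁻¹ (subst₂ _≤_ (+-comm ∣ Q ∣ 1) (trans (sym (apart⇒∣∪∣ Q#A)) size) (+-monoʳ-≤ ∣ Q ∣ (1≤∣∣⁺ e∈A)))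

      -- If `A` had a third edge, `Q` with the two claiming edges would be tight of size at most
      -- `k`, and growth inside `A` would again meet size `k`.
      leaf-size : ∀ {Q A x y} → OneCluster G A → Tight Q → Apart Q A → ∣ Q ∪ A ∣ ≡ suc k →
        x ≢ y → x ∈ V G Q → y ∈ V G Q → Two A x y → ∣ A ∣ ≡ 2
      leaf-size {Q} {A} cA tQ Q#A size x≢y xQ yQ (f , g , f≢g , f∈A , g∈A , c , x∈ , y∈) with 3 ≤? ∣ A ∣
      ... | no 3≰ = ≤-antisym (s≤s⁻¹ (≰⇒> 3≰)) (2≤∣∣⁺ f≢g f∈A g∈A)
      ... | yes 3≤ = ⊥-elim (cluster-blocks cA (tight-two tQ f∉Q g∉Q f≢g c x≢y xQ yQ x∈ y∈)
              (f , x∈p∩q⁺ (f∈A , ∪ʳ (∪ˡ (x∈⁅x⁆ f))))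
              (s≤s⁻¹ (subst₂ _≤_ (trans (+-suc ∣ Q ∣ 2) (cong suc (sym (∪-size₂ f∉Q g∉Q f≢g))))
                (trans (sym (apart⇒∣∪∣ Q#A)) size) (+-monoʳ-≤ ∣ Q ∣ 3≤)))
              (≤-trans (n≤1+n k) (≤-trans (≤-reflexive (sym size)) (∣∪∣-enlarge Q _ A))))
        where
        f∉Q : f ∉ Q
        f∉Q f∈Q = Q#A f∈Q f∈A
        g∉Q : g ∉ Q
        g∉Q g∈Q = Q#A g∈Q g∈A

      -- By `leaf-¬one` no edge of `A` has two vertices in `V G Q`. If one had none, `x` and `y`
      -- would both lie on the other edge, again against `leaf-¬one`.
      leaf-flexible : ∀ {Q A x y} → OneCluster G A → Tight Q → Apart Q A → ∣ Q ∪ A ∣ ≡ suc k →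
        x ≢ y → x ∈ V G Q → y ∈ V G Q → Two A x y → FlexibleDiamond G (Q ∪ A) A
      leaf-flexible {Q} {A} {x} {y} cA tQ Q#A size x≢y xQ yQ t@(f , g , f≢g , f∈A , g∈A , c , x∈ , y∈) =
        ∪ʳ , (f , g , f≢g , f∈A , g∈A , ∣A∣≡2 , close⇒≡2 f≢g c) , λ e e∈A → ≤-antisym (meet≤1 e∈A) (1≤meet e∈A)
        where
        ∣A∣≡2 : ∣ A ∣ ≡ 2
        ∣A∣≡2 = leaf-size cA tQ Q#A size x≢y xQ yQ t

        rest : Subset m
        rest = (Q ∪ A) ─ A

        rest⊆Q : rest ⊆ Q
        rest⊆Q h with ─⁻ {p = Q ∪ A} h
        ... | h₁ , h₂ = [ id , (λ h′ → contradiction h′ h₂) ]′ (∪⁻ h₁)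

        Q⊆rest : Q ⊆ rest
        Q⊆rest h = ─⁺ (∪ˡ h) (Q#A h)

        meet≤1 : ∀ {e} → e ∈ A → ∣ G e ∩ V G rest ∣ ≤ 1
        meet≤1 {e} e∈A = s≤s⁻¹ (≰⇒> λ 2≤ → many (2≤∣∣⁻ {p = G e ∩ V G rest} 2≤))
          where
          many : ∃[ u ] ∃[ v ] (u ≢ v × u ∈ G e ∩ V G rest × v ∈ G e ∩ V G rest) → ⊥
          many (u , v , u≢v , u∈ , v∈) with ∩⁻ {p = G e} u∈ | ∩⁻ {p = G e} v∈
          ... | u∈e , u∈r | v∈e , v∈r = leaf-¬one cA tQ Q#A size u≢v (V-mono {rest} {Q} rest⊆Q u∈r)
                  (V-mono {rest} {Q} rest⊆Q v∈r) (e , e∈A , u∈e , v∈e)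

        separated : ∀ {e e′} → e ∈ A → e′ ∈ A → (∀ {z} → z ∈ G f ∪ G g → z ∈ G e ⊎ z ∈ G e′) →
          ∃[ z ] (z ∈ G e × z ∈ V G Q)
        separated {e′ = e′} e∈A e′∈A side with side x∈ | side y∈
        ... | inj₁ x∈e | _ = x , x∈e , xQ
        ... | inj₂ _ | inj₁ y∈e = y , y∈e , yQ
        ... | inj₂ x∈e′ | inj₂ y∈e′ = ⊥-elim (leaf-¬one cA tQ Q#A size x≢y xQ yQ (e′ , e′∈A , x∈e′ , y∈e′))

        1≤meet : ∀ {e} → e ∈ A → 1 ≤ ∣ G e ∩ V G rest ∣
        1≤meet {e} e∈A with pair-cover ∣A∣≡2 f≢g f∈A g∈A e∈A
        ... | inj₁ refl = let z , z∈e , zQ = separated f∈A g∈A ∪⁻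
                          in 1≤∣∣⁺ (x∈p∩q⁺ (z∈e , V-mono {Q} {rest} Q⊆rest zQ))
        ... | inj₂ refl = let z , z∈e , zQ = separated g∈A f∈A (λ h → swap (∪⁻ h))
                          in 1≤∣∣⁺ (x∈p∩q⁺ (z∈e , V-mono {Q} {rest} Q⊆rest zQ))


      -- Chains and the sequences of Property P

      toChain : ∀ l {Ts : Fin (2 + l) → Subset m} → MergeInOrder G (2 + s) Ts →
        Chain (Ts zero) (Ts (suc zero)) (total Ts) (Ts (fromℕ (suc l)))
      toChain zero {Ts} mio@(clusters , _) =
        subst (λ K → Chain (Ts zero) (Ts (suc zero)) K (Ts (suc zero)))
          (sym (trans (total-last Ts) (cong (_∪ Ts (suc zero)) (∪-identityʳ (Ts zero)))))
          (start (clusters zero) (clusters (suc zero)) (empty⇒apart (proj₁ merge)) (mergeable⇒link merge))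
        where
        merge : Mergeable G (2 + s) (Ts zero) (Ts (suc zero))
        merge = subst (λ K → Mergeable G (2 + s) K (Ts (suc zero))) (∪-identityʳ (Ts zero)) (merge-last G (2 + s) mio)
      toChain (suc l) {Ts} mio@(clusters , _) =
        subst (λ K → Chain (Ts zero) (Ts (suc zero)) K (Ts (fromℕ (2 + l)))) (sym (total-last Ts))
          (toChain l (merge-init G (2 + s) mio) ▸
            (clusters (fromℕ (2 + l)) , empty⇒apart (proj₁ (merge-last G (2 + s) mio)) , mergeable⇒link (merge-last G (2 + s) mio)))

      fromChain : ∀ {A B K C} → Chain A B K C → ∃[ l ] Σ (Fin (2 + l) → Subset m) λ Ts →
        MergeInOrder G (2 + s) Ts × total Ts ≡ K × Ts zero ≡ A × Ts (suc zero) ≡ B × Ts (fromℕ (suc l)) ≡ C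
      fromChain {A} {B} (start cA cB d l) = 0 , const A ▷ B ,
        merge-▷ G (2 + s) ((λ _ → cA) , λ { zero () ; (suc ()) }) cB
          (subst (λ K → Mergeable G (2 + s) K B) (sym (∪-identityʳ A)) (link⇒mergeable d l)) ,
        trans (total-▷ G (const A) B) (cong (_∪ B) (∪-identityʳ A)) , refl , refl , refl
        where
        const : Subset m → Fin 1 → Subset m
        const X _ = X
      fromChain (_▸_ {D = D} ch (cD , d , l)) with fromChain ch
      ... | i , Ts , mio , refl , A≡ , B≡ , _ = suc i , Ts ▷ D ,
        merge-▷ G (2 + s) mio cD (link⇒mergeable d l) , total-▷ G Ts D , A≡ , B≡ , ▷-fromℕ Ts D

      -- The conclusion of `PropertyP` at a single cluster, stated so that `PropertyP` unfolds to a
      -- function into `Witness F T`.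
      Witness : Subset m → Subset m → Set
      Witness F T =
        ∃[ l ] Σ (Fin (2 + l) → Subset m) λ Ts →
          let H     = total Ts
              Tfst  = Ts zero
              Tsnd  = Ts (suc zero)
              Tlast = Ts (fromℕ (suc l))
              Tprev = Ts (inject₁ (fromℕ l))
          in MergeInOrder G (2 + s) Ts × H ⊆ F × ∣ H ∣ ≡ suc k
             × (∃[ p ] Ts p ≡ T)
             × FlexibleDiamond G H Tfst × FlexibleDiamond G H Tlast
             × (∃[ x ] ∃[ y ] (x ≢ y × Claims¬12 G (2 + s) Tfst x y × Claims G (2 + s) Tsnd x y 1))
             × (∃[ x ] ∃[ y ] (x ≢ y × Claims¬12 G (2 + s) Tlast x y × Claims G (2 + s) Tprev x y 1))

      widen : ∀ {F F′ T} → F ⊆ F′ → Witness F T → Witness F′ T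
      widen F⊆F′ (l , Ts , mio , H⊆F , rest) = l , Ts , mio , (λ h → F⊆F′ (H⊆F h)) , rest

      assemble : ∀ {A B C D H F T x y u v l} {Ts : Fin (2 + l) → Subset m} → MergeInOrder G (2 + s) Ts →
        total Ts ≡ H → Ts zero ≡ A → Ts (suc zero) ≡ B → Ts (inject₁ (fromℕ l)) ≡ C → Ts (fromℕ (suc l)) ≡ D →
        H ⊆ F → ∣ H ∣ ≡ suc k → OneCluster G T → T ⊆ H →
        FlexibleDiamond G H A → FlexibleDiamond G H D →
        x ≢ y → Two A x y → ¬ One A x y → One B x y →
        u ≢ v → Two D u v → ¬ One D u v → One C u v → Witness F T
      assemble {T = T} {x} {y} {u} {v} {l} {Ts} mio@(clusters , _) refl refl refl refl refl H⊆F size cT@((t , t∈T) , _) T⊆H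
        flexA flexD x≢y twoA ¬oneA oneB u≢v twoD ¬oneD oneC =
        -- An edge of `T` lies in some entry of the sequence, and 1-clusters sharing an edge
        -- coincide.
        l , Ts , mio , H⊆F , size , (let p , _ , t∈p = ∈selUnion⁻ {sel = λ _ → true} {f = Ts} (T⊆H t∈T) in p , meet⇒≡ (clusters p) cT t∈p t∈T) ,
        flexA , flexD ,
        (x , y , x≢y , (Two⇒claims twoA , λ c → ¬oneA (claims⇒One {Ts zero} {x} {y} c)) , One⇒claims oneB) ,
        (u , v , u≢v , (Two⇒claims twoD , λ c → ¬oneD (claims⇒One {Ts (fromℕ (suc l))} {u} {v} c)) , One⇒claims oneC)

      -- Only the merging structure has to be supplied: `A` and `D` are leaves with connected
      -- complements `Q` and `K` in the same set of `k + 1` edges, so the leaf lemmas yield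
      -- flexibility and the missing 1-claims at both ends.
      witness : ∀ {A B K C D Q F T x y u v} → Chain A B K C → OneCluster G D → Apart K D →
        K ∪ D ⊆ F → ∣ K ∪ D ∣ ≡ suc k → OneCluster G T → T ⊆ K ∪ D →
        Conn Q → Apart Q A → K ∪ D ≡ Q ∪ A → B ⊆ Q →
        x ≢ y → Two A x y → One B x y → u ≢ v → Two D u v → One C u v → Witness F T
      witness {A} {B} {K} {C} {D} {Q} {x = x} {y} {u} {v} ch cD K#D KD⊆F size cT T⊆ cQ Q#A KD≡QA B⊆Q x≢y twoA oneB u≢v twoD oneC
        with fromChain (ch ▸ (cD , K#D , u , v , u≢v , inj₁ (One-mono (proj₂ (chain-last ch)) oneC , twoD))) | fromChain ch
      ... | _ | i , Ts , mio , refl , A≡ , B≡ , C≡ =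
        assemble (merge-▷ G (2 + s) mio cD (link⇒mergeable K#D (u , v , u≢v , inj₁ (oneK , twoD)))) (total-▷ G Ts D) A≡ B≡
          (trans (▷-inject₁ Ts D (fromℕ (suc i))) C≡) (▷-fromℕ Ts D) KD⊆F size cT T⊆
          (subst (λ H → FlexibleDiamond G H A) (sym KD≡QA) (leaf-flexible cA tQ Q#A size′ x≢y xQ yQ twoA))
          (leaf-flexible cD tK K#D size u≢v uK vK twoD)
          x≢y twoA (leaf-¬one cA tQ Q#A size′ x≢y xQ yQ) oneB
          u≢v twoD (leaf-¬one cD tK K#D size u≢v uK vK) oneC
        where
        cA = proj₁ (chain-first ch)
        tQ = conn⇒tight cQ
        tK = conn⇒tight (chain-conn ch)
        size′ : ∣ Q ∪ A ∣ ≡ suc k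
        size′ = trans (cong ∣_∣ (sym KD≡QA)) size
        oneQ : One Q x y
        oneQ = One-mono B⊆Q oneB
        oneK : One K u v
        oneK = One-mono (proj₂ (chain-last ch)) oneC
        xQ = proj₁ (One⇒V oneQ)
        yQ = proj₂ (One⇒V oneQ)
        uK = proj₁ (One⇒V oneK)
        vK = proj₂ (One⇒V oneK)

      -- The data of Property P, with A, B, N, Z for T_1, T_2, T_{ℓ-1}, T_ℓ and K for T_1 ∪ … ∪ T_{ℓ-1};
      -- ℓ = 2 is excluded by flexibility, so K contains both A and N.
      record Backbone (F T : Subset m) : Set where
        field
          {A B K N Z} : Subset m
          chain  : Chain A B K N
          cZ     : OneCluster G Z
          K#Z    : Apart K Z
          H⊆F    : K ∪ Z ⊆ F
          size   : ∣ K ∪ Z ∣ ≡ suc k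
          T⊆H    : T ⊆ K ∪ Z
          flexA  : FlexibleDiamond G (K ∪ Z) A
          flexZ  : FlexibleDiamond G (K ∪ Z) Z
          {x y u v} : Fin n
          x≢y    : x ≢ y
          twoA   : Two A x y
          oneB   : One B x y
          u≢v    : u ≢ v
          twoZ   : Two Z u v
          oneN   : One N u v

      backbone : ∀ {F T} → Witness F T → Backbone F T
      -- With only two clusters, the edge of the second that 1-claims the pair would have both `x`
      -- and `y` among the vertices of the first, while flexibility allows one such vertex.
      backbone (zero , Ts , mio@(clusters , _) , _ , _ , _ , _ , flex , (x , y , x≢y , (two , _) , one) , _) =
        ⊥-elim (x≢y (contact-unique (clusters (suc zero)) flex e∈ x∈ y∈ (outer (proj₁ inV)) (outer (proj₂ inV))))
        where
        chain₀ = toChain zero mio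
        one′ : One (Ts (suc zero)) x y
        one′ = claims⇒One one
        e∈ = proj₁ (proj₂ one′)
        x∈ = proj₁ (proj₂ (proj₂ one′))
        y∈ = proj₂ (proj₂ (proj₂ one′))
        two′ : Two (Ts zero) x y
        two′ = claims⇒Two two
        inV = Two⇒V two′
        outer : V G (Ts zero) ⊆ V G (total Ts ─ Ts (suc zero))
        outer = V-mono {Ts zero} {total Ts ─ Ts (suc zero)} λ h →
          ─⁺ (proj₂ (chain-first chain₀) h) (proj₂ (proj₂ (chain-second chain₀)) h)
      backbone {F} (suc l , Ts , mio@(clusters , _) , H⊆F , size , (p , refl) , flex , flex′ ,
                    (x , y , x≢y , (two , _) , one) , (u , v , u≢v , (two′ , _) , one′)) = record
        { chain = toChain l (merge-init G (2 + s) mio)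
        ; cZ    = clusters (fromℕ (2 + l))
        ; K#Z   = empty⇒apart (proj₁ (merge-last G (2 + s) mio))
        ; H⊆F   = subst (_⊆ F) H≡ H⊆F
        ; size  = trans (cong ∣_∣ (sym H≡)) size
        ; T⊆H   = subst (Ts p ⊆_) H≡ (∈selUnion⁺ {sel = λ _ → true} {f = Ts} p refl)
        ; flexA = subst (λ H → FlexibleDiamond G H _) H≡ flex
        ; flexZ = subst (λ H → FlexibleDiamond G H _) H≡ flex′
        ; x≢y   = x≢y
        ; twoA  = claims⇒Two {Ts zero} {x} {y} two
        ; oneB  = claims⇒One {Ts (suc zero)} {x} {y} one
        ; u≢v   = u≢v
        ; twoZ  = claims⇒Two two′
        ; oneN  = claims⇒One one′
        }
        where
        H≡ : total Ts ≡ total (Ts ∘ inject₁) ∪ Ts (fromℕ (2 + l))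
        H≡ = total-last Ts

      -- The merging process

      module _ (π : MergeProcess G (2 + s)) where

        open MergeProcess π using (steps; stage; step)

        stage-conn : ∀ j → j ≤ steps → ∀ {X} → stage j X → Conn X
        stage-conn zero _ {X} PX = cluster-conn (Equivalence.to (MergeProcess.start π X) PX)
        stage-conn (suc j) j<steps {X} PX with step j j<steps
        ... | A , B , PA , PB , _ , merge , iff with Equivalence.to (iff X) PX
        ...   | inj₁ (PX′ , _) = stage-conn j (<⇒≤ j<steps) PX′
        ...   | inj₂ refl = conn-∪ (stage-conn j (<⇒≤ j<steps) PA) (stage-conn j (<⇒≤ j<steps) PB) (mergeable⇒link merge)

        stage-apart : ∀ j → j ≤ steps → ∀ {X Y} → stage j X → stage j Y → X ≡ Y ⊎ Apart X Y
        stage-apart zero _ {X} {Y} PX PY with nonempty? (X ∩ Y)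
        ... | no empty = inj₂ (empty⇒apart empty)
        ... | yes (e , e∈) = inj₁ (meet⇒≡ (Equivalence.to (MergeProcess.start π X) PX)
                (Equivalence.to (MergeProcess.start π Y) PY) (proj₁ (∩⁻ {p = X} e∈)) (proj₂ (∩⁻ {p = X} e∈)))
        stage-apart (suc j) j<steps {X} {Y} PX PY with step j j<steps
        ... | A , B , PA , PB , _ , _ , iff = compare (Equivalence.to (iff X) PX) (Equivalence.to (iff Y) PY)
          where
          earlier : ∀ {X Y} → stage j X → stage j Y → X ≢ Y → Apart X Y
          earlier PX PY X≢Y = [ (λ X≡Y → contradiction X≡Y X≢Y) , (λ d {e} → d {e}) ]′ (stage-apart j (<⇒≤ j<steps) PX PY)

          from-merged : ∀ {X} → stage j X → X ≢ A → X ≢ B → Apart X (A ∪ B)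
          from-merged PX X≢A X≢B h h′ = [ earlier PX PA X≢A h , earlier PX PB X≢B h ]′ (∪⁻ h′)

          compare : ∀ {X Y} → (stage j X × X ≢ A × X ≢ B) ⊎ X ≡ A ∪ B → (stage j Y × Y ≢ A × Y ≢ B) ⊎ Y ≡ A ∪ B →
            X ≡ Y ⊎ Apart X Y
          compare (inj₁ (PX , _)) (inj₁ (PY , _)) = stage-apart j (<⇒≤ j<steps) PX PY
          compare (inj₁ (PX , X≢A , X≢B)) (inj₂ refl) = inj₂ (from-merged PX X≢A X≢B)
          compare (inj₂ refl) (inj₁ (PY , Y≢A , Y≢B)) = inj₂ λ h h′ → from-merged PY Y≢A Y≢B h′ h
          compare (inj₂ refl) (inj₂ refl) = inj₁ refl

        -- Induction on the number `d` of later merges: containment in one of the two merged parts,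
        -- or disjointness from both, passes to their union.
        laminar : ∀ d i → d + i ≤ steps → ∀ {X Y} → stage i X → stage (d + i) Y → X ⊆ Y ⊎ Apart X Y
        laminar zero i i≤ PX PY with stage-apart i i≤ PX PY
        ... | inj₁ refl = inj₁ id
        ... | inj₂ d = inj₂ d
        laminar (suc d) i lt {X} {Y} PX PY with step (d + i) lt
        ... | A , B , PA , PB , _ , _ , iff with Equivalence.to (iff Y) PY
        ...   | inj₁ (PY′ , _) = laminar d i (<⇒≤ lt) PX PY′
        ...   | inj₂ refl with laminar d i (<⇒≤ lt) PX PA | laminar d i (<⇒≤ lt) PX PB
        ...     | inj₁ X⊆A | _ = inj₁ λ h → ∪ˡ (X⊆A h)
        ...     | inj₂ _ | inj₁ X⊆B = inj₁ λ h → ∪ʳ (X⊆B h)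
        ...     | inj₂ X#A | inj₂ X#B = inj₂ λ h h′ → [ X#A h , X#B h ]′ (∪⁻ h′)

        module _ {F S : Subset m} (cS : OneCluster G S) (F#S : Apart F S) where

          private
            S⊈F : F ∪ S ⊈ F
            S⊈F h with proj₁ cS
            ... | e , e∈S = F#S (h (∪ʳ e∈S)) e∈S

            sibling : ∀ {B} → Conn B → Apart F B → B ⊆ F ∪ S → S ≡ B
            sibling {B} cB F#B B⊆ = ⊆-antisym S⊆B B⊆S
              where
              B⊆S : B ⊆ S
              B⊆S h = [ (λ f → contradiction h (F#B f)) , id ]′ (∪⁻ (B⊆ h))
              S⊆B : S ⊆ B
              S⊆B with inhabited cB
              ... | b , b∈B = absorb (union cB) cS (B⊆S b∈B) b∈B

            merge-partner : ∀ {j B} → j ≤ steps → stage j F → stage j B → F ≢ B → F ∪ B ⊆ F ∪ S ⊎ Apart (F ∪ B) (F ∪ S) →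
              Link F B → Link F S
            merge-partner {j} j≤ PF PB F≢B below l with stage-apart j j≤ PF PB | below
            ... | inj₁ F≡B | _ = contradiction F≡B F≢B
            ... | inj₂ F#B | inj₁ ⊆FS = subst (Link F) (sym (sibling (stage-conn j j≤ PB) F#B (λ h → ⊆FS (∪ʳ h)))) l
            ... | inj₂ _ | inj₂ d with inhabited (stage-conn j j≤ PF)
            ...   | e , e∈F = contradiction (∪ˡ e∈F) (d (∪ˡ e∈F))

          -- Follow `F` to the merge that absorbs it, say with `B`. Since `F ∪ B` meets the later
          -- part `F ∪ S`, laminarity puts it inside. Then `B` is a nonempty union of 1-clusters
          -- contained in `S`, hence `B` is `S`.
          merged-directly : ∀ d j → d + j ≤ steps → stage j F → stage (d + j) (F ∪ S) → Link F S
          merged-directly zero j j≤ PF PFS with stage-apart j j≤ PF PFS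
          ... | inj₁ F≡ = ⊥-elim (S⊈F (⊆-reflexive (sym F≡)))
          ... | inj₂ d with inhabited (stage-conn j j≤ PF)
          ...   | e , e∈F = contradiction (∪ˡ e∈F) (d e∈F)
          merged-directly (suc d) j lt PF PFS with step j (≤-trans (s≤s (m≤n+m j d)) lt)
          ... | A , B , PA , PB , A≢B , merge , iff with F ≟ˢ A | F ≟ˢ B
          ...   | yes refl | _ = merge-partner j≤ PF PB A≢B
                  (laminar d (suc j) lt′ (Equivalence.from (iff (F ∪ B)) (inj₂ refl)) PFS′) (mergeable⇒link merge)
            where
            j≤ = ≤-trans (m≤n+m j (suc d)) lt
            lt′ = subst (_≤ steps) (sym (+-suc d j)) lt
            PFS′ = subst (λ i → stage i (F ∪ S)) (sym (+-suc d j)) PFS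
          ...   | no _ | yes refl = merge-partner j≤ PF PA (λ F≡A → A≢B (sym F≡A))
                  (laminar d (suc j) lt′ (Equivalence.from (iff (F ∪ A)) (inj₂ (∪-comm F A))) PFS′)
                  (Link-sym (mergeable⇒link merge))
            where
            j≤ = ≤-trans (m≤n+m j (suc d)) lt
            lt′ = subst (_≤ steps) (sym (+-suc d j)) lt
            PFS′ = subst (λ i → stage i (F ∪ S)) (sym (+-suc d j)) PFS
          ...   | no F≢A | no F≢B = merged-directly d (suc j) (subst (_≤ steps) (sym (+-suc d j)) lt)
                  (Equivalence.from (iff F) (inj₁ (PF , F≢A , F≢B))) (subst (λ i → stage i (F ∪ S)) (sym (+-suc d j)) PFS)

          partial⇒link : PartialTwoCluster G π F → PartialTwoCluster G π (F ∪ S) → Link F S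
          partial⇒link (j , j≤ , PF) (j′ , j′≤ , PFS) with ≤-total j j′
          ... | inj₁ le = merged-directly (j′ ∸ j) j (subst (_≤ steps) (sym (m∸n+n≡m le)) j′≤) PF
                            (subst (λ i → stage i (F ∪ S)) (sym (m∸n+n≡m le)) PFS)
          -- If `F ∪ S` appeared no later than `F`, laminarity would make it a subset of `F` or
          -- disjoint from `F`; both are absurd.
          ... | inj₂ ge with laminar (j ∸ j′) j′ (subst (_≤ steps) (sym (m∸n+n≡m ge)) j≤) PFS
                               (subst (λ i → stage i F) (sym (m∸n+n≡m ge)) PF)
          ...   | inj₁ FS⊆F = ⊥-elim (S⊈F FS⊆F)
          ...   | inj₂ d with inhabited (stage-conn j j≤ PF)
          ...     | e , e∈F = contradiction e∈F (d (∪ˡ e∈F))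

      -- Exchanging an end diamond

      module BackboneFacts {F T : Subset m} (b : Backbone F T) where

        open Backbone b public

        cK : Conn K
        cK = chain-conn chain

        cA : OneCluster G A
        cA = proj₁ (chain-first chain)

        A⊆K : A ⊆ K
        A⊆K = proj₂ (chain-first chain)

        cN : OneCluster G N
        cN = proj₁ (chain-last chain)

        N⊆K : N ⊆ K
        N⊆K = proj₂ (chain-last chain)

        K⊆F : K ⊆ F
        K⊆F h = H⊆F (∪ˡ h)

        diamond-size : ∀ {H D} → FlexibleDiamond G H D → ∣ D ∣ ≡ 2
        diamond-size (_ , (_ , _ , _ , _ , _ , ∣D∣≡2 , _) , _) = ∣D∣≡2

        -- In the notation of Property P this is `T_1 ∪ … ∪ T_{ℓ-2}`; it contains `A` because `K`
        -- consists of at least two clusters.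
        R : Subset m
        R = proj₁ (chain-split chain)

        cR : Conn R
        cR = proj₁ (proj₂ (chain-split chain))

        A⊆R : A ⊆ R
        A⊆R = proj₁ (proj₂ (proj₂ (chain-split chain)))

        R#N : Apart R N
        R#N = proj₁ (proj₂ (proj₂ (proj₂ (chain-split chain))))

        K≡R∪N : K ≡ R ∪ N
        K≡R∪N = proj₂ (proj₂ (proj₂ (proj₂ (chain-split chain))))

        R⊆K : R ⊆ K
        R⊆K h = subst (_ ∈_) (sym K≡R∪N) (∪ˡ h)

        N⊆K─A : N ⊆ K ─ A
        N⊆K─A h = ─⁺ (N⊆K h) λ a → R#N (A⊆R a) h

        Z⊆H─A : Z ⊆ (K ∪ Z) ─ A
        Z⊆H─A h = ─⁺ (∪ʳ h) λ a → K#Z (A⊆K a) h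

        conn-K─A : Conn (K ─ A)
        conn-K─A = conn-─ cA flexA cK A⊆K ∪ˡ (let e , e∈N = proj₁ cN in e , N⊆K─A e∈N)

        conn-H─A : Conn ((K ∪ Z) ─ A)
        conn-H─A = conn-─ cA flexA
          (conn-∪ cK (cluster-conn cZ) (u , v , u≢v , inj₁ (One-mono N⊆K oneN , twoZ)))
          (λ h → ∪ˡ (A⊆K h)) id (let e , e∈Z = proj₁ cZ in e , Z⊆H─A e∈Z)

        ∣K∣ : suc ∣ K ∣ ≡ k
        ∣K∣ = suc-injective (trans (+-comm 2 ∣ K ∣)
          (trans (sym (trans (apart⇒∣∪∣ K#Z) (cong (∣ K ∣ +_) (diamond-size flexZ)))) size))

        ∣H─A∣ : suc ∣ (K ∪ Z) ─ A ∣ ≡ k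
        ∣H─A∣ = suc-injective (trans (+-comm 2 ∣ (K ∪ Z) ─ A ∣) (trans (sym (trans (apart⇒∣∪∣ (─-apart {p = K ∪ Z} {A}))
          (cong (∣ (K ∪ Z) ─ A ∣ +_) (diamond-size flexA))))
          (trans (cong ∣_∣ (─∪-cancel (λ h → ∪ˡ (A⊆K h)))) size)))

      module Merging {F S : Subset m} (cF : Conn F) (cS : OneCluster G S) (F#S : Apart F S)
                     (PF : PropertyP G (2 + s) k F) where

        -- Removing either end diamond from the `k + 1` edges of `H` leaves a connected, hence
        -- tight, set of `k - 1` edges. Removing `Z` keeps `A`, and removing `A` keeps every other
        -- cluster.
        tight-part : ∀ {T} → OneCluster G T → T ⊆ F → ∃[ Q ] (Q ⊆ F × T ⊆ Q × Tight Q × suc ∣ Q ∣ ≡ k)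
        tight-part {T} cT T⊆F = choose (T ≟ˢ A)
          where
          open BackboneFacts (backbone (PF T cT T⊆F))

          choose : Dec (T ≡ A) → ∃[ Q ] (Q ⊆ F × T ⊆ Q × Tight Q × suc ∣ Q ∣ ≡ k)
          choose (yes T≡A) = K , K⊆F , subst (_⊆ K) (sym T≡A) A⊆K , conn⇒tight cK , ∣K∣
          choose (no T≢A) = (K ∪ Z) ─ A , (λ h → H⊆F (proj₁ (─⁻ {p = K ∪ Z} h))) ,
            (λ h → ─⁺ (T⊆H h) λ a → T≢A (meet⇒≡ cT cA h a)) , conn⇒tight conn-H─A , ∣H─A∣

        -- The claiming edges of `F` are close, so one 1-cluster holds both. The tight set of size
        -- `k - 1` around it would accept the edge of `S` and reach size `k`.
        ¬two-one : ∀ {x y} → x ≢ y → Two F x y → ¬ One S x y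
        ¬two-one x≢y (f , g , f≢g , f∈F , g∈F , c , x∈ , y∈) (e , e∈S , x∈e , y∈e) with union cF f∈F
        ... | T , cT , f∈T , T⊆F with tight-part cT T⊆F
        ...   | Q , Q⊆F , T⊆Q , tQ , ∣Q∣ = ¬tight-k (tight-edge tQ e∉Q x≢y (∈V-pair f∈Q g∈Q x∈) (∈V-pair f∈Q g∈Q y∈) x∈e y∈e)
                (trans (∣insert∣ e∉Q) ∣Q∣)
          where
          e∉Q : e ∉ Q
          e∉Q h = F#S (Q⊆F h) e∈S
          f∈Q : f ∈ Q
          f∈Q = T⊆Q f∈T
          g∈Q : g ∈ Q
          g∈Q = T⊆Q (close-closed (cluster-union cT) (union cF) f∈T g∈F c)

        k≤∣F∣ : k ≤ ∣ F ∣
        k≤∣F∣ with inhabited cF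
        ... | e , e∈F with union cF e∈F
        ...   | T , cT , _ , T⊆F = ≤-trans (n≤1+n k) (≤-trans (≤-reflexive (sym size)) (p⊆q⇒∣p∣≤∣q∣ H⊆F))
          where open BackboneFacts (backbone (PF T cT T⊆F))

        ∣S∣≡2 : ∀ {x y} → x ≢ y → One F x y → Two S x y → ∣ S ∣ ≡ 2
        ∣S∣≡2 {x} {y} x≢y (e , e∈F , x∈e , y∈e) (f , g , f≢g , f∈S , g∈S , c , x∈ , y∈) with 3 ≤? ∣ S ∣
        ... | no 3≰ = ≤-antisym (s≤s⁻¹ (≰⇒> 3≰)) (2≤∣∣⁺ f≢g f∈S g∈S)
        ... | yes 3≤ = ⊥-elim (blocked (m≤n⇒m<n∨m≡n 3≤k))
          where
          W : Subset m
          W = ⁅ e ⁆ ∪ (⁅ f ⁆ ∪ ⁅ g ⁆)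

          ∉e : ∀ {h} → h ∈ S → h ∉ ⁅ e ⁆
          ∉e h∈S h∈e = F#S e∈F (subst (_∈ S) (⁅⁆⁻ h∈e) h∈S)

          tW : Tight W
          tW = tight-two (tight-⁅⁆ e) (∉e f∈S) (∉e g∈S) f≢g c x≢y (∈V⁺ (x∈⁅x⁆ e) x∈e) (∈V⁺ (x∈⁅x⁆ e) y∈e) x∈ y∈

          ∣W∣≡3 : ∣ W ∣ ≡ 3
          ∣W∣≡3 = trans (∪-size₂ (∉e f∈S) (∉e g∈S) f≢g) (cong (_+ 2) (∣⁅x⁆∣≡1 e))

          blocked : 3 < k ⊎ 3 ≡ k → ⊥
          blocked (inj₂ 3≡k) = ¬tight-k tW (trans ∣W∣≡3 3≡k)
          -- The three edges of `W` lack `k ∸ 4` to size `k - 1`. Growth adds only edges of `F`, so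
          -- a third edge `h` of `S` stays outside `X` and `X ∪ S` has at least `k` edges.
          blocked (inj₁ 3<k) with grow-to cF k≤∣F∣ (k ∸ 4) W (trans (cong (λ w → suc (w + (k ∸ 4))) ∣W∣≡3) (m+[n∸m]≡n 3<k))
                                    tW (e , x∈p∩q⁺ (e∈F , ∪ˡ (x∈⁅x⁆ e)))
                                | ∃-beyond S (⁅ f ⁆ ∪ ⁅ g ⁆) (subst (_< ∣ S ∣) (sym (∣pair∣ f≢g)) 3≤)
          ... | X , W⊆X , X⊆ , tX , ∣X∣ | h , h∈S , h∉fg = cluster-blocks cS tX
                  (f , x∈p∩q⁺ (f∈S , W⊆X (∪ʳ (∪ˡ (x∈⁅x⁆ f))))) (≤-trans (n≤1+n _) (≤-reflexive ∣X∣))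
                  (≤-trans (≤-reflexive (sym (trans (∣insert∣ h∉X) ∣X∣)))
                    (p⊆q⇒∣p∣≤∣q∣ {p = X ∪ ⁅ h ⁆} {q = X ∪ S} (∪-⊆ ∪ˡ (λ z → ∪ʳ (⁅⁆⊆ h∈S z)))))
            where
            h∉X : h ∉ X
            h∉X h∈X with ∪⁻ {p = W} (X⊆ h∈X)
            ... | inj₂ h∈F = F#S h∈F h∈S
            ... | inj₁ h∈W = [ ∉e h∈S , h∉fg ]′ (∪⁻ h∈W)

        -- S hangs from X, and X hangs from the cluster J of M: the sequence runs from a cluster L that comes
        -- last in some merging order of M starting at J, through the rest of M, to X and finally S.
        hanging : ∀ {M X J x y u v} → Conn M → M ⊆ F → OneCluster G X → X ⊆ F → Apart M X →
          OneCluster G J → J ⊆ M → u ≢ v → One J u v → Two X u v → ∣ (M ∪ X) ∪ S ∣ ≡ suc k →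
          x ≢ y → One X x y → Two S x y → Witness (F ∪ S) S
        hanging {M} {X} {J} {x} {y} {u} {v} cM M⊆F cX X⊆F M#X cJ J⊆M u≢v oneJ twoX size x≢y oneX twoS = choose (M ⊆? J)
          where
          conn-∪-S : ∀ {K} → Conn K → X ⊆ K → Conn (K ∪ S)
          conn-∪-S cK X⊆K = conn-∪ cK (cluster-conn cS) (x , y , x≢y , inj₁ (One-mono X⊆K oneX , twoS))

          conn-∪-X : ∀ {K} → Conn K → J ⊆ K → Conn (K ∪ X)
          conn-∪-X cK J⊆K = conn-∪ cK (cluster-conn cX) (u , v , u≢v , inj₁ (One-mono J⊆K oneJ , twoX))

          uv∈V : ∀ {K} → X ⊆ K → u ∈ V G K × v ∈ V G K
          uv∈V {K} X⊆K = V-mono {X} {K} X⊆K (proj₁ (Two⇒V twoX)) , V-mono {X} {K} X⊆K (proj₂ (Two⇒V twoX))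

          extend : (∃[ W ] ∃[ L ] (Conn W × OneCluster G L × J ⊆ W × Apart W L × Link W L × M ≡ W ∪ L)) → Witness (F ∪ S) S
          extend (W , L , cW , cL , J⊆W , W#L , l , refl) = branch (localize (union cW) (Link-sym l))
            where
            Q : Subset m
            Q = (W ∪ X) ∪ S

            cQ : Conn Q
            cQ = conn-∪-S (conn-∪-X cW J⊆W) ∪ʳ

            Q#L : Apart Q L
            Q#L q∈ l∈ = [ (λ h → [ (λ w → W#L w l∈) , M#X (∪ʳ l∈) ]′ (∪⁻ h)) , F#S (M⊆F (∪ʳ l∈)) ]′ (∪⁻ q∈)

            H≡Q∪L : ((W ∪ L) ∪ X) ∪ S ≡ Q ∪ L
            H≡Q∪L = trans (cong (_∪ S) (∪-swap W L X)) (∪-swap (W ∪ X) L S)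

            W⊆Q : W ⊆ Q
            W⊆Q h = ∪ˡ (∪ˡ h)

            branch : ∃[ B ] (OneCluster G B × B ⊆ W × Link L B) → Witness (F ∪ S) S
            -- `L` is a leaf of the set of `k + 1` edges, so it cannot be the 1-claiming side of its
            -- link.
            branch (B , cB , B⊆W , p , q , p≢q , inj₁ (oneL , twoB)) =
              ⊥-elim (leaf-¬one cL (conn⇒tight cQ) Q#L (trans (cong ∣_∣ (sym H≡Q∪L)) size) p≢q
                (proj₁ (Two⇒V twoQ)) (proj₂ (Two⇒V twoQ)) oneL)
              where
              twoQ : Two Q p q
              twoQ = Two-mono (λ h → W⊆Q (B⊆W h)) twoB
            branch (B , cB , B⊆W , p , q , p≢q , inj₂ (oneB , twoL)) =
              witness
                (proj₂ (chain-extend cM (start cL cB (λ h h′ → W#L (B⊆W h′) h) (p , q , p≢q , inj₂ (oneB , twoL)))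
                         (∪-⊆ ∪ʳ (λ h → ∪ˡ (B⊆W h))))
                  ▸ (cX , M#X , u , v , u≢v , inj₁ (One-mono J⊆M oneJ , twoX)))
                cS (λ h → F#S (∪-⊆ M⊆F X⊆F h)) (∪-⊆ (λ h → ∪ˡ (∪-⊆ M⊆F X⊆F h)) ∪ʳ) size cS ∪ʳ
                cQ Q#L H≡Q∪L (λ h → W⊆Q (B⊆W h)) p≢q twoL oneB x≢y twoS oneX

          choose : Dec (M ⊆ J) → Witness (F ∪ S) S
          choose (no M⊈J) = extend (last-cluster cM (cluster-conn cJ) J⊆M M⊈J)
          choose (yes M⊆J) with ⊆-antisym M⊆J J⊆M
          -- If `M` were just `J`, then `J` would be a leaf that 1-claims a pair of vertices of the
          -- rest `X ∪ S`.
          ... | refl = ⊥-elim (leaf-¬one cJ (conn⇒tight (conn-∪-S (cluster-conn cX) id))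
                  (λ q∈ j∈ → [ M#X j∈ , F#S (M⊆F j∈) ]′ (∪⁻ q∈))
                  (trans (cong ∣_∣ (trans (∪-swap X S M) (cong (_∪ S) (∪-comm X M)))) size)
                  u≢v (proj₁ (uv∈V ∪ˡ)) (proj₂ (uv∈V ∪ˡ)) oneJ)

        witness-S : ∀ {x y} → x ≢ y → One F x y → Two S x y → Witness (F ∪ S) S
        witness-S {x} {y} x≢y oneF@(e , e∈F , x∈e , y∈e) twoS with union cF e∈F
        ... | T , cT , e∈T , T⊆F = place (T ≟ˢ A) (T ≟ˢ Z) (T ≟ˢ N)
          where
          open BackboneFacts (backbone (PF T cT T⊆F))
            renaming (x to x₁; y to y₁; x≢y to x₁≢y₁)

          oneT : One T x y
          oneT = e , e∈T , x∈e , y∈e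

          as : ∀ {X} → T ≡ X → One X x y
          as T≡X = subst (λ X → One X x y) T≡X oneT

          with-S : ∀ {K} → K ⊆ F → suc ∣ K ∣ ≡ k → ∣ K ∪ S ∣ ≡ suc k
          with-S {K} K⊆F ∣K∣ = trans (apart⇒∣∪∣ (λ h → F#S (K⊆F h)))
            (trans (cong (∣ K ∣ +_) (∣S∣≡2 x≢y oneF twoS)) (trans (+-comm ∣ K ∣ 2) (cong suc ∣K∣)))

          H─A⊆F : (K ∪ Z) ─ A ⊆ F
          H─A⊆F h = H⊆F (proj₁ (─⁻ {p = K ∪ Z} h))

          K─A⊆F : K ─ A ⊆ F
          K─A⊆F h = K⊆F (proj₁ (─⁻ {p = K} h))

          B⊆K─A : B ⊆ K ─ A
          B⊆K─A h = ─⁺ (proj₁ (proj₂ (chain-second chain)) h) λ a → proj₂ (proj₂ (chain-second chain)) a h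

          K─A∪Z≡ : (K ─ A) ∪ Z ≡ (K ∪ Z) ─ A
          K─A∪Z≡ = ⊆-antisym (∪-⊆ (λ h → let h₁ , h₂ = ─⁻ {p = K} h in ─⁺ (∪ˡ h₁) h₂) Z⊆H─A) back
            where
            back : (K ∪ Z) ─ A ⊆ (K ─ A) ∪ Z
            back h with ─⁻ {p = K ∪ Z} h
            ... | h₁ , h₂ = [ (λ h′ → ∪ˡ (─⁺ h′ h₂)) , ∪ʳ ]′ (∪⁻ h₁)

          -- `S` replaces `Z`. In `K` the diamond `A` hangs from `B`, so `A` becomes the penultimate
          -- cluster and a new first end is taken from `K ─ A`.
          at-A : T ≡ A → Witness (F ∪ S) S
          at-A T≡A = hanging conn-K─A K─A⊆F cA (λ h → K⊆F (A⊆K h)) (─-apart {p = K})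
            (proj₁ (chain-second chain)) B⊆K─A x₁≢y₁ oneB twoA
            (trans (cong (λ p → ∣ p ∪ S ∣) (─∪-cancel A⊆K)) (with-S K⊆F ∣K∣)) x≢y (as T≡A) twoS

          -- `S` replaces `A`. Here `Z`, hanging from `N`, becomes penultimate.
          at-Z : T ≡ Z → Witness (F ∪ S) S
          at-Z T≡Z = hanging conn-K─A K─A⊆F cZ (λ h → H⊆F (∪ʳ h)) (λ h → K#Z (proj₁ (─⁻ {p = K} h)))
            cN N⊆K─A u≢v oneN twoZ
            (trans (cong (λ p → ∣ p ∪ S ∣) K─A∪Z≡) (with-S H─A⊆F ∣H─A∣)) x≢y (as T≡Z) twoS

          -- `S` replaces `Z`, and the old order of `K` survives because `N` already comes last in
          -- it.
          at-N : T ≡ N → Witness (F ∪ S) S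
          at-N T≡N = witness chain cS (λ h → F#S (K⊆F h)) (∪-⊆ (λ h → ∪ˡ (K⊆F h)) ∪ʳ) (with-S K⊆F ∣K∣) cS ∪ʳ
            (conn-∪ conn-K─A (cluster-conn cS) (x , y , x≢y , inj₁ (One-mono N⊆K─A (as T≡N) , twoS)))
            (λ h a → [ (λ h′ → proj₂ (─⁻ {p = K} h′) a) , F#S (K⊆F (A⊆K a)) ]′ (∪⁻ h))
            (trans (cong (_∪ S) (sym (─∪-cancel A⊆K))) (∪-swap (K ─ A) A S))
            (λ h → ∪ˡ (B⊆K─A h)) x₁≢y₁ twoA oneB x≢y twoS (as T≡N)

          -- `S` replaces `A` as the first cluster, with `T` second; the remaining clusters of
          -- `R ─ A` follow in some order, and `N` and `Z` stay at the end.
          inside-R : T ⊆ R ─ A → Witness (F ∪ S) S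
          inside-R T⊆ = witness
            (proj₂ (chain-extend conn-S∪K₀ (start cS cT (λ h h′ → F#S (T⊆F h′) h) (x , y , x≢y , inj₂ (oneT , twoS)))
                     (∪-⊆ ∪ˡ (λ h → ∪ʳ (T⊆ h))))
              ▸ (cN , S∪K₀#N , Link-mono ∪ʳ id link-N))
            cZ new#Z (λ h → H-new⊆F∪S (subst (_ ∈_) H-new≡ h)) (trans (cong ∣_∣ H-new≡) (with-S H─A⊆F ∣H─A∣)) cS
            (λ h → subst (_ ∈_) (sym H-new≡) (∪ʳ h))
            conn-H─A (λ h → F#S (H─A⊆F h)) H-new≡ (λ h → K₀⊆H─A (T⊆ h)) x≢y twoS oneT u≢v twoZ oneN
            where
            K₀ : Subset m
            K₀ = R ─ A

            t₀ : Nonempty K₀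
            t₀ = e , T⊆ e∈T

            cK₀ : Conn K₀
            cK₀ = conn-─ cA flexA cR A⊆R (λ h → ∪ˡ (R⊆K h)) t₀

            K₀⊆K─A : K₀ ⊆ K ─ A
            K₀⊆K─A h with ─⁻ {p = R} h
            ... | h₁ , h₂ = ─⁺ (R⊆K h₁) h₂

            K₀⊆H─A : K₀ ⊆ (K ∪ Z) ─ A
            K₀⊆H─A h with ─⁻ {p = R} h
            ... | h₁ , h₂ = ─⁺ (∪ˡ (R⊆K h₁)) h₂

            K₀#N : Apart K₀ N
            K₀#N h = R#N (proj₁ (─⁻ {p = R} h))

            conn-S∪K₀ : Conn (S ∪ K₀)
            conn-S∪K₀ = conn-∪ (cluster-conn cS) cK₀ (x , y , x≢y , inj₂ (One-mono T⊆ oneT , twoS))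

            link-N : Link K₀ N
            -- In `K ─ A` everything outside `K₀` lies in `N`, so a link across this cut must end in
            -- `N`.
            link-N = Link-mono id rest (cut conn-K─A K₀⊆K─A t₀ (union cK₀) K─A⊈K₀)
              where
              K─A⊈K₀ : K ─ A ⊈ K₀
              K─A⊈K₀ h with proj₁ cN
              ... | i , i∈N = K₀#N (h (N⊆K─A i∈N)) i∈N
              rest : (K ─ A) ─ K₀ ⊆ N
              rest h with ─⁻ {p = K ─ A} h
              ... | h₁ , h₂ with ─⁻ {p = K} h₁
              ...   | h₃ , h₄ = [ (λ r → contradiction (─⁺ r h₄) h₂) , id ]′ (∪⁻ (subst (_ ∈_) K≡R∪N h₃))

            S∪K₀#N : Apart (S ∪ K₀) N
            S∪K₀#N h i∈N = [ F#S (K⊆F (N⊆K i∈N)) , (λ h′ → K₀#N h′ i∈N) ]′ (∪⁻ h)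

            new#Z : Apart ((S ∪ K₀) ∪ N) Z
            new#Z h i∈Z = [ (λ h′ → [ F#S (H⊆F (∪ʳ i∈Z)) , (λ h″ → K#Z (R⊆K (proj₁ (─⁻ {p = R} h″))) i∈Z) ]′ (∪⁻ h′))
                          , (λ h′ → K#Z (N⊆K h′) i∈Z) ]′ (∪⁻ h)

            H-new≡ : ((S ∪ K₀) ∪ N) ∪ Z ≡ ((K ∪ Z) ─ A) ∪ S
            H-new≡ = ⊆-antisym
              (∪-⊆ (∪-⊆ (∪-⊆ ∪ʳ (λ h → ∪ˡ (K₀⊆H─A h)))
                (λ h → ∪ˡ (let h₁ , h₂ = ─⁻ {p = K} (N⊆K─A h) in ─⁺ (∪ˡ h₁) h₂))) (λ h → ∪ˡ (Z⊆H─A h)))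
              (∪-⊆ back (λ h → ∪ˡ (∪ˡ (∪ˡ h))))
              where
              back : (K ∪ Z) ─ A ⊆ ((S ∪ K₀) ∪ N) ∪ Z
              back h with ─⁻ {p = K ∪ Z} h
              ... | h₁ , h₂ = [ (λ i → [ (λ r → ∪ˡ (∪ˡ (∪ʳ (─⁺ r h₂)))) , (λ i′ → ∪ˡ (∪ʳ i′)) ]′
                                         (∪⁻ (subst (_ ∈_) K≡R∪N i)))
                              , ∪ʳ ]′ (∪⁻ h₁)

            H-new⊆F∪S : ((K ∪ Z) ─ A) ∪ S ⊆ F ∪ S
            H-new⊆F∪S = ∪-⊆ (λ h → ∪ˡ (H─A⊆F h)) ∪ʳ

          place : Dec (T ≡ A) → Dec (T ≡ Z) → Dec (T ≡ N) → Witness (F ∪ S) S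
          place (yes T≡A) _ _ = at-A T≡A
          place (no _) (yes T≡Z) _ = at-Z T≡Z
          place (no _) (no _) (yes T≡N) = at-N T≡N
          place (no T≢A) (no T≢Z) (no T≢N) = inside-R T⊆R─A
            where
            T⊆R─A : T ⊆ R ─ A
            T⊆R─A h with ∪⁻ {p = K} (T⊆H h)
            ... | inj₂ i = contradiction (meet⇒≡ cT cZ h i) T≢Z
            ... | inj₁ i = [ (λ r → ─⁺ r λ a → T≢A (meet⇒≡ cT cA h a)) , (λ j → contradiction (meet⇒≡ cT cN h j) T≢N) ]′
                             (∪⁻ (subst (_ ∈_) K≡R∪N i))

        merged-property : Link F S → ∣ S ∣ ≡ 2 × PropertyP G (2 + s) k (F ∪ S)
        merged-property (_ , _ , x≢y , inj₂ (oneS , twoF)) = ⊥-elim (¬two-one x≢y twoF oneS)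
        merged-property (_ , _ , x≢y , inj₁ (oneF , twoS)) = ∣S∣≡2 x≢y oneF twoS , property
          where
          property : PropertyP G (2 + s) k (F ∪ S)
          property T cT T⊆ with T ⊆? F
          ... | yes T⊆F = widen ∪ˡ (PF T cT T⊆F)
          ... | no T⊈F with ⊈⇒witness T⊈F
          ...   | t , t∈T , t∉F with meet⇒≡ cT cS t∈T ([ (λ h → contradiction h t∉F) , id ]′ (∪⁻ (T⊆ t∈T)))
          ...     | refl = witness-S x≢y oneF twoS

theorem3p6 : (r k : ℕ) → 3 ≤ r → 3 ≤ k →
    {n m : ℕ} (G : Fin m → Subset n) → IsRGraph r G → GkFree G r k →
    (π : MergeProcess G r) →
    (F : Subset m) → PartialTwoCluster G π F → PropertyP G r k F →
    (S : Subset m) → OneCluster G S → S ⊈ F → PartialTwoCluster G π (F ∪ S) →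
    ∣ S ∣ ≡ 2 × PropertyP G r k (F ∪ S)
-- With `r` in the form `2 + s`, `r ∸ 2` computes to `s`, and the bounds of the family agree with
-- those of `Tight`.
theorem3p6 (suc (suc s)) k (s≤s (s≤s _)) 3≤k {m = m} G (_ , ∣G∣) free π F PF@(j , j≤ , at-j) propF S cS S⊈F PFS =
  Merging.merged-property G ∣G∣ 3≤k free cF cS F#S propF (partial⇒link G ∣G∣ 3≤k free π cS F#S PF PFS)
  where
  cF : Conn G F
  cF = stage-conn G ∣G∣ 3≤k free π j j≤ at-j

  F#S : Apart F S
  -- `F` is a union of 1-clusters, so a single common edge would put all of `S` inside `F`.
  F#S e∈F e∈S = S⊈F (absorb G ∣G∣ (Conn.union cF) cS e∈S e∈F)
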